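{- Let $n\ge 2$ and let $T$ be any tree on $n$ vertices. Let $L_n$ denote the path (linear tree) on $n$ vertices and $S_n$ the star tree on $n$ vertices. Under a uniformly random linear arrangement of the vertices, with $D$ the sum of edge lengths, $$\mathbb{E}_{rla}[D^2](L_n)\le \mathbb{E}_{rla}[D^2](T)\le \mathbb{E}_{rla}[D^2](S_n),\qquad \mathbb{V}_{rla}[D](L_n)\le \mathbb{V}_{rla}[D](T)\le \mathbb{V}_{rla}[D](S_n),$$ where $$\mathbb{E}_{rla}[D^2](L_n)=\tfrac{1}{90}(n+1)(10n^3-6n^2-25n+24),\quad \mathbb{V}_{rla}[D](L_n)=\tfrac{1}{90}(n+1)(n-2)(4n-7),$$ $$\mathbb{E}_{rla}[D^2](S_n)=\tfrac{1}{60}(n+1)(n-1)(7n^2-8),\quad \mathbb{V}_{rla}[D](S_n)=\tfrac{1}{180}(n+1)(n-1)(n+2)(n-2).$$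
   Context: A linear arrangement of the vertex set $V$ ($|V|=n$) is a bijection $\pi:V\to\{1,\dots,n\}$; the length of an edge $\{u,v\}$ is $|\pi(u)-\pi(v)|$; $D$ is the sum of the lengths of all edges. In a uniformly random linear arrangement $\pi$ is uniform over all $n!$ bijections; $\mathbb{E}_{rla}[D^2](G)$ and $\mathbb{V}_{rla}[D](G)$ denote the second moment and variance of $D$ for graph $G$ under this choice. The star tree $S_n$ has one vertex adjacent to all $n-1$ others. -}

module Defs where

open import Data.Nat as ℕ using (ℕ; zero; suc; _∸_; ∣_-_∣; _^_)
open import Data.Fin using (Fin; zero; suc; toℕ; _<_; _≟_)
open import Data.Nat.ListAction using (sum)
open import Data.List using (List; []; _∷_; map; length; concatMap; filter)
open import Data.List.Relation.Unary.All using (All)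
open import Data.List.Relation.Unary.Unique.Propositional using (Unique)
open import Data.List.Membership.Propositional using (_∈_)
open import Data.Vec using (Vec; []; _∷_; lookup; toList)
open import Data.Product using (_×_; _,_)
open import Data.Integer as ℤ using (ℤ; +_)
open import Data.Rational as ℚ using (ℚ; 0ℚ)
open import Relation.Binary.PropositionalEquality using (_≡_)
import Data.List.Relation.Unary.Unique.DecPropositional as UDec

-- Graphs on the vertex set Fin n, given by a list of edges.
-- An edge {u,v} is stored as the ordered pair (u , v) with toℕ u < toℕ v.

Edge : ℕ → Set
Edge n = Fin n × Fin n

IsSimple : ∀ {n} → List (Edge n) → Set
IsSimple es = All (λ { (u , v) → u < v }) es × Unique es

data Reach {n : ℕ} (es : List (Edge n)) : Fin n → Fin n → Set where
  here  : ∀ {u} → Reach es u u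
  fwd   : ∀ {u v w} → (u , v) ∈ es → Reach es v w → Reach es u w
  bwd   : ∀ {u v w} → (v , u) ∈ es → Reach es v w → Reach es u w

Connected : ∀ {n} → List (Edge n) → Set
Connected {n} es = (u v : Fin n) → Reach es u v

IsTree : ∀ n → List (Edge n) → Set
IsTree n es = IsSimple es × Connected es × (length es ≡ n ∸ 1)

-- the path (linear tree) L_n : edges {i, i+1}
pathEdges : ∀ n → List (Edge n)
pathEdges zero = []
pathEdges (suc zero) = []
pathEdges (suc (suc k)) = (zero , suc zero) ∷ map (λ { (u , v) → (suc u , suc v) }) (pathEdges (suc k))

starEdges : ∀ n → List (Edge n)
starEdges zero = []
starEdges (suc k) = map (λ i → (zero , suc i)) (Data.List.allFin k)

-- Linear arrangements: π is a vector whose i-th entry is the position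
-- (0-based) of vertex i; arrangements are exactly the injective vectors
-- (= bijections Fin n → Fin n).

allVecs : ∀ n k → List (Vec (Fin n) k)
allVecs n zero = [] ∷ []
allVecs n (suc k) = concatMap (λ x → map (x ∷_) (allVecs n k)) (Data.List.allFin n)

arrangements : ∀ n → List (Vec (Fin n) n)
arrangements n = filter (λ π → UDec.unique? _≟_ (toList π)) (allVecs n n)

D : ∀ {n} → Vec (Fin n) n → List (Edge n) → ℕ
D π es = sum (map (λ { (u , v) → ∣ toℕ (lookup π u) - toℕ (lookup π v) ∣ }) es)

mean : List ℕ → ℚ
mean xs with length xs
... | zero  = 0ℚ
... | suc k = (+ sum xs) ℚ./ suc k

E-D : ∀ n → List (Edge n) → ℚ
E-D n es = mean (map (λ π → D π es) (arrangements n))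

E-D² : ∀ n → List (Edge n) → ℚ
E-D² n es = mean (map (λ π → D π es ^ 2) (arrangements n))

V-D : ∀ n → List (Edge n) → ℚ
V-D n es = E-D² n es ℚ.- (E-D n es ℚ.* E-D n es)

module Submission where

-- Expanding D² writes the sum of D² over all arrangements as a sum over ordered pairs of
-- edges of the total of their length products, and that total only depends on whether the
-- two edges are equal, adjacent or disjoint: it is weight₂, weight₁ or weight₀, computed
-- from sums of distances between points of {0, …, n - 1}.  A tree has n - 1 equal pairs
-- and (n - 1)(n - 2) other pairs, among which the adjacent ones number Σ_v d_v (d_v - 1);
-- this is at least 2(n - 2) because d² - 3d + 2 ≥ 0 for d ≥ 1, with equality for the path,
-- and at most (n - 1)(n - 2), attained by the star.  Faulhaber's formulas evaluate the
-- distance sums in closed form; they give weight₀ ≤ weight₁, so E[D²] grows with the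
-- number of adjacent pairs, and the exact moments of the path and the star.  E[D] is the
-- same for all trees, so the variance is ordered like E[D²].

module Combinatorics where

  open import Defs
  open import Data.Nat using (ℕ; zero; suc; _+_; _*_; _∸_; _≤_; _<_; z≤n; s≤s; ∣_-_∣; _^_; _!)
  import Data.Nat.Properties as ℕₚ
  open import Data.Nat.ListAction using (sum)
  open import Data.Nat.ListAction.Properties using (sum-++)
  open import Data.Fin using (Fin; zero; suc; toℕ; punchIn; punchOut; _≟_)
  import Data.Fin.Properties as Finₚ
  open import Data.List using (List; []; _∷_; _++_; map; length; concatMap; filter; allFin)
  import Data.List.Properties as Listₚ
  open import Data.List.Relation.Unary.All as All using (All; []; _∷_)
  import Data.List.Relation.Unary.All.Properties as Allₚ
  open import Data.List.Relation.Unary.AllPairs using ([]; _∷_)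
  open import Data.List.Relation.Unary.Unique.Propositional using (Unique)
  import Data.List.Relation.Unary.Unique.DecPropositional as UniqueDec
  open import Data.List.Membership.Propositional using (_∈_)
  import Data.List.Membership.Propositional.Properties as ∈ₚ
  open import Data.List.Relation.Unary.Any using (here; there)
  open import Data.Vec as Vec using (Vec; []; _∷_; lookup; toList)
  open import Data.Product using (_×_; _,_; proj₁; proj₂)
  open import Data.Sum using (_⊎_; inj₁; inj₂)
  open import Data.Bool using (true; false; if_then_else_)
  open import Data.Empty using (⊥-elim)
  open import Function using (id)
  open import Relation.Nullary using (Dec; yes; no; ¬_; does)
  open import Relation.Binary.PropositionalEquality
    using (_≡_; _≢_; refl; sym; trans; cong; cong₂; subst; subst₂; module ≡-Reasoning)
  open import Data.Nat.Tactic.RingSolver using (solve-∀)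

  ∑ : {A : Set} → List A → (A → ℕ) → ℕ
  ∑ xs f = sum (map f xs)

  syntax ∑ xs (λ x → e) = ∑[ x ← xs ] e

  ∑< : ∀ n → (Fin n → ℕ) → ℕ
  ∑< n f = ∑ (allFin n) f

  syntax ∑< n (λ x → e) = ∑[ x < n ] e

  module _ {A : Set} where

    ∑-cong : (xs : List A) {f g : A → ℕ} → (∀ x → f x ≡ g x) → ∑ xs f ≡ ∑ xs g
    ∑-cong []       f≗g = refl
    ∑-cong (x ∷ xs) f≗g = cong₂ _+_ (f≗g x) (∑-cong xs f≗g)

    ∑-cong-All : ∀ {P : A → Set} (xs : List A) → All P xs → {f g : A → ℕ} →
                 (∀ x → P x → f x ≡ g x) → ∑ xs f ≡ ∑ xs g
    ∑-cong-All []       []         f≗g = refl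
    ∑-cong-All (x ∷ xs) (px ∷ pxs) f≗g = cong₂ _+_ (f≗g x px) (∑-cong-All xs pxs f≗g)

    ∑-++ : (xs ys : List A) (f : A → ℕ) → ∑ (xs ++ ys) f ≡ ∑ xs f + ∑ ys f
    ∑-++ xs ys f = trans (cong sum (Listₚ.map-++ f xs ys)) (sum-++ (map f xs) (map f ys))

    ∑-zero : (xs : List A) → ∑[ x ← xs ] 0 ≡ 0
    ∑-zero []       = refl
    ∑-zero (x ∷ xs) = ∑-zero xs

    ∑-const : (xs : List A) (c : ℕ) → ∑[ x ← xs ] c ≡ length xs * c
    ∑-const []       c = refl
    ∑-const (x ∷ xs) c = cong (c +_) (∑-const xs c)

    ∑-distrib-+ : (xs : List A) (f g : A → ℕ) → ∑[ x ← xs ] (f x + g x) ≡ ∑ xs f + ∑ xs g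
    ∑-distrib-+ []       f g = refl
    ∑-distrib-+ (x ∷ xs) f g = begin
      f x + g x + ∑[ y ← xs ] (f y + g y) ≡⟨ cong (f x + g x +_) (∑-distrib-+ xs f g) ⟩
      f x + g x + (∑ xs f + ∑ xs g)       ≡⟨ interchange (f x) (g x) (∑ xs f) (∑ xs g) ⟩
      f x + ∑ xs f + (g x + ∑ xs g)       ∎
      where
      open ≡-Reasoning
      interchange : ∀ a b c d → a + b + (c + d) ≡ a + c + (b + d)
      interchange = solve-∀

    ∑-*ˡ : (xs : List A) (c : ℕ) (f : A → ℕ) → ∑[ x ← xs ] (c * f x) ≡ c * ∑ xs f
    ∑-*ˡ []       c f = sym (ℕₚ.*-zeroʳ c)
    ∑-*ˡ (x ∷ xs) c f = trans (cong (c * f x +_) (∑-*ˡ xs c f)) (sym (ℕₚ.*-distribˡ-+ c (f x) (∑ xs f)))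

    ∑-*ʳ : (xs : List A) (c : ℕ) (f : A → ℕ) → ∑[ x ← xs ] (f x * c) ≡ ∑ xs f * c
    ∑-*ʳ xs c f = trans (∑-cong xs (λ x → ℕₚ.*-comm (f x) c)) (trans (∑-*ˡ xs c f) (ℕₚ.*-comm c _))

    ∑-mono-≤ : (xs : List A) {f g : A → ℕ} → (∀ x → f x ≤ g x) → ∑ xs f ≤ ∑ xs g
    ∑-mono-≤ []       f≤g = z≤n
    ∑-mono-≤ (x ∷ xs) f≤g = ℕₚ.+-mono-≤ (f≤g x) (∑-mono-≤ xs f≤g)

    ∈⇒≤∑ : (xs : List A) (f : A → ℕ) {x : A} → x ∈ xs → f x ≤ ∑ xs f
    ∈⇒≤∑ (y ∷ xs) f (here refl) = ℕₚ.m≤m+n (f y) _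
    ∈⇒≤∑ (y ∷ xs) f (there x∈) = ℕₚ.≤-trans (∈⇒≤∑ xs f x∈) (ℕₚ.m≤n+m _ (f y))

    ∑-filter : ∀ {P : A → Set} (P? : ∀ x → Dec (P x)) (xs : List A) (f : A → ℕ) →
               ∑ (filter P? xs) f ≡ ∑[ x ← xs ] (if does (P? x) then f x else 0)
    ∑-filter P? []       f = refl
    ∑-filter P? (x ∷ xs) f with does (P? x)
    ... | true  = cong (f x +_) (∑-filter P? xs f)
    ... | false = ∑-filter P? xs f

  module _ {A B : Set} where

    ∑-map : (g : A → B) (xs : List A) (f : B → ℕ) → ∑ (map g xs) f ≡ ∑[ x ← xs ] f (g x)
    ∑-map g xs f = cong sum (sym (Listₚ.map-∘ xs))

    ∑-concatMap : (g : A → List B) (xs : List A) (f : B → ℕ) →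
                  ∑ (concatMap g xs) f ≡ ∑[ x ← xs ] ∑ (g x) f
    ∑-concatMap g []       f = refl
    ∑-concatMap g (x ∷ xs) f = trans (∑-++ (g x) (concatMap g xs) f) (cong (∑ (g x) f +_) (∑-concatMap g xs f))

    ∑-comm : (xs : List A) (ys : List B) (f : A → B → ℕ) →
             ∑[ x ← xs ] ∑[ y ← ys ] f x y ≡ ∑[ y ← ys ] ∑[ x ← xs ] f x y
    ∑-comm []       ys f = sym (∑-zero ys)
    ∑-comm (x ∷ xs) ys f =
      trans (cong (∑ ys (f x) +_) (∑-comm xs ys f)) (sym (∑-distrib-+ ys (f x) (λ y → ∑[ x′ ← xs ] f x′ y)))

  ∑<-suc : ∀ n (f : Fin (suc n) → ℕ) → ∑[ x < suc n ] f x ≡ f zero + ∑[ x < n ] f (suc x)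
  ∑<-suc n f = cong (f zero +_) (trans (cong (λ l → ∑ l f) (sym (Listₚ.map-tabulate id suc))) (∑-map suc (allFin n) f))

  ∑<-const : ∀ n c → ∑[ x < n ] c ≡ n * c
  ∑<-const n c = trans (∑-const (allFin n) c) (cong (_* c) (Listₚ.length-tabulate {n = n} id))

  module _ {n : ℕ} where

    𝟙-Unique : List (Fin n) → ℕ
    𝟙-Unique l = if does (UniqueDec.unique? _≟_ l) then 1 else 0

    𝟙-Unique-yes : {l : List (Fin n)} → Unique l → 𝟙-Unique l ≡ 1
    𝟙-Unique-yes {l} u with UniqueDec.unique? _≟_ l
    ... | yes _ = refl
    ... | no ¬u = ⊥-elim (¬u u)

    𝟙-Unique-no : {l : List (Fin n)} → ¬ Unique l → 𝟙-Unique l ≡ 0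
    𝟙-Unique-no {l} ¬u with UniqueDec.unique? _≟_ l
    ... | yes u = ⊥-elim (¬u u)
    ... | no _  = refl

    𝟙-Unique-cong : {l l′ : List (Fin n)} → (Unique l → Unique l′) → (Unique l′ → Unique l) →
                    𝟙-Unique l ≡ 𝟙-Unique l′
    𝟙-Unique-cong {l} {l′} to from with UniqueDec.unique? _≟_ l | UniqueDec.unique? _≟_ l′
    ... | yes _ | yes _  = refl
    ... | no _  | no _   = refl
    ... | yes u | no ¬u′ = ⊥-elim (¬u′ (to u))
    ... | no ¬u | yes u′ = ⊥-elim (¬u (from u′))

    if-Unique : (l : List (Fin n)) (a : ℕ) →
                (if does (UniqueDec.unique? _≟_ l) then a else 0) ≡ 𝟙-Unique l * a
    if-Unique l a with UniqueDec.unique? _≟_ l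
    ... | yes _ = sym (ℕₚ.+-identityʳ a)
    ... | no _  = refl

    δ : Fin n → Fin n → ℕ
    δ x y = if does (x ≟ y) then 1 else 0

    δ-refl : (x : Fin n) → δ x x ≡ 1
    δ-refl x with x ≟ x
    ... | yes _ = refl
    ... | no x≢x = ⊥-elim (x≢x refl)

    δ-≢ : {x y : Fin n} → x ≢ y → δ x y ≡ 0
    δ-≢ {x} {y} x≢y with x ≟ y
    ... | yes x≡y = ⊥-elim (x≢y x≡y)
    ... | no _    = refl

    δ-sym : (x y : Fin n) → δ x y ≡ δ y x
    δ-sym x y with x ≟ y | y ≟ x
    ... | yes _   | yes _   = refl
    ... | no _    | no _    = refl
    ... | yes x≡y | no y≢x  = ⊥-elim (y≢x (sym x≡y))
    ... | no x≢y  | yes y≡x = ⊥-elim (x≢y (sym y≡x))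

    δ-0∨1 : (x y : Fin n) → δ x y ≡ 0 ⊎ δ x y ≡ 1
    δ-0∨1 x y with x ≟ y
    ... | yes _ = inj₂ refl
    ... | no _  = inj₁ refl

    𝟙∉ : Fin n → List (Fin n) → ℕ
    𝟙∉ x []      = 1
    𝟙∉ x (y ∷ s) = if does (x ≟ y) then 0 else 𝟙∉ x s

    𝟙∉-0∨1 : (x : Fin n) (s : List (Fin n)) → 𝟙∉ x s ≡ 0 ⊎ 𝟙∉ x s ≡ 1
    𝟙∉-0∨1 x []      = inj₂ refl
    𝟙∉-0∨1 x (y ∷ s) with x ≟ y
    ... | yes _ = inj₁ refl
    ... | no _  = 𝟙∉-0∨1 x s

    𝟙∉≡1⇒All≢ : (x : Fin n) (s : List (Fin n)) → 𝟙∉ x s ≡ 1 → All (_≢ x) s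
    𝟙∉≡1⇒All≢ x []      _ = []
    𝟙∉≡1⇒All≢ x (y ∷ s) e with x ≟ y
    ... | yes _  = ⊥-elim (ℕₚ.0≢1+n e)
    ... | no x≢y = (λ y≡x → x≢y (sym y≡x)) ∷ 𝟙∉≡1⇒All≢ x s e

    𝟙∉+∑δ : (x : Fin n) (s : List (Fin n)) → Unique s → 𝟙∉ x s + ∑ s (δ x) ≡ 1
    𝟙∉+∑δ x []      _         = refl
    𝟙∉+∑δ x (y ∷ s) (y∉s ∷ u) with x ≟ y
    ... | yes refl = cong suc (∑δ≡0 y∉s)
      where
      ∑δ≡0 : ∀ {s′} → All (x ≢_) s′ → ∑ s′ (δ x) ≡ 0
      ∑δ≡0 []         = refl
      ∑δ≡0 (x≢z ∷ ps) = cong₂ _+_ (δ-≢ x≢z) (∑δ≡0 ps)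
    ... | no _ = 𝟙∉+∑δ x s u

  ∑δ≡1 : ∀ n (y : Fin n) → ∑[ x < n ] δ x y ≡ 1
  ∑δ≡1 (suc n) zero    = trans (∑<-suc n (λ x → δ x zero)) (cong₂ _+_ (δ-refl {suc n} zero)
    (trans (∑-cong (allFin n) (λ x → δ-≢ {x = suc x} {y = zero} λ ())) (∑-zero (allFin n))))
  ∑δ≡1 (suc n) (suc y) = trans (∑<-suc n (λ x → δ x (suc y)))
    (cong₂ _+_ (δ-≢ {x = zero} {y = suc y} λ ()) (trans (∑-cong (allFin n) δ-suc) (∑δ≡1 n y)))
    where
    δ-suc : ∀ x → δ (suc x) (suc y) ≡ δ x y
    δ-suc x with x ≟ y
    ... | yes refl = refl
    ... | no _     = refl

  ∑δ* : ∀ n (y : Fin n) (f : Fin n → ℕ) → ∑[ x < n ] (δ x y * f x) ≡ f y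
  ∑δ* n y f = begin
    ∑[ x < n ] (δ x y * f x) ≡⟨ ∑-cong (allFin n) δ*-at-y ⟩
    ∑[ x < n ] (δ x y * f y) ≡⟨ ∑-*ʳ (allFin n) (f y) (λ x → δ x y) ⟩
    ∑[ x < n ] δ x y * f y   ≡⟨ cong (_* f y) (∑δ≡1 n y) ⟩
    1 * f y                  ≡⟨ ℕₚ.*-identityˡ (f y) ⟩
    f y                      ∎
    where
    open ≡-Reasoning
    δ*-at-y : ∀ x → δ x y * f x ≡ δ x y * f y
    δ*-at-y x with x ≟ y
    ... | yes refl = refl
    ... | no _     = refl

  ∑𝟙∉ : ∀ n (s : List (Fin n)) → Unique s → (f : Fin n → ℕ) →
        ∑[ x < n ] (𝟙∉ x s * f x) + ∑ s f ≡ ∑[ x < n ] f x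
  ∑𝟙∉ n s u f = begin
    ∑[ x < n ] (𝟙∉ x s * f x) + ∑ s f
      ≡⟨ cong (∑[ x < n ] (𝟙∉ x s * f x) +_) (sym (∑-cong s (λ y → ∑δ* n y f))) ⟩
    ∑[ x < n ] (𝟙∉ x s * f x) + ∑[ y ← s ] ∑[ x < n ] (δ x y * f x)
      ≡⟨ cong (∑[ x < n ] (𝟙∉ x s * f x) +_) (∑-comm s (allFin n) (λ y x → δ x y * f x)) ⟩
    ∑[ x < n ] (𝟙∉ x s * f x) + ∑[ x < n ] ∑[ y ← s ] (δ x y * f x)
      ≡⟨ sym (∑-distrib-+ (allFin n) _ _) ⟩
    ∑[ x < n ] (𝟙∉ x s * f x + ∑[ y ← s ] (δ x y * f x))
      ≡⟨ ∑-cong (allFin n) split ⟩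
    ∑[ x < n ] f x ∎
    where
    open ≡-Reasoning
    split : ∀ x → 𝟙∉ x s * f x + ∑[ y ← s ] (δ x y * f x) ≡ f x
    split x = begin
      𝟙∉ x s * f x + ∑[ y ← s ] (δ x y * f x) ≡⟨ cong (𝟙∉ x s * f x +_) (∑-*ʳ s (f x) (δ x)) ⟩
      𝟙∉ x s * f x + ∑ s (δ x) * f x          ≡⟨ sym (ℕₚ.*-distribʳ-+ (f x) (𝟙∉ x s) (∑ s (δ x))) ⟩
      (𝟙∉ x s + ∑ s (δ x)) * f x              ≡⟨ cong (_* f x) (𝟙∉+∑δ x s u) ⟩
      1 * f x                                  ≡⟨ ℕₚ.*-identityˡ (f x) ⟩
      f x                                      ∎

  ∑𝟙∉+length : ∀ n (s : List (Fin n)) → Unique s → ∑[ x < n ] 𝟙∉ x s + length s ≡ n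
  ∑𝟙∉+length n s u = begin
    ∑[ x < n ] 𝟙∉ x s + length s
      ≡⟨ cong₂ _+_ (∑-cong (allFin n) (λ x → sym (ℕₚ.*-identityʳ (𝟙∉ x s))))
                   (sym (trans (∑-const s 1) (ℕₚ.*-identityʳ (length s)))) ⟩
    ∑[ x < n ] (𝟙∉ x s * 1) + ∑[ x ← s ] 1
      ≡⟨ ∑𝟙∉ n s u (λ _ → 1) ⟩
    ∑[ x < n ] 1
      ≡⟨ trans (∑<-const n 1) (ℕₚ.*-identityʳ n) ⟩
    n ∎
    where open ≡-Reasoning

  Unique⇒length≤ : ∀ {n} (s : List (Fin n)) → Unique s → length s ≤ n
  Unique⇒length≤ {n} s u = subst (length s ≤_) (∑𝟙∉+length n s u) (ℕₚ.m≤n+m (length s) _)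

  module _ {A : Set} where

    Unique-++⁻ˡ : (a b : List A) → Unique (a ++ b) → Unique a
    Unique-++⁻ˡ []      b _         = []
    Unique-++⁻ˡ (x ∷ a) b (px ∷ u) = Allₚ.++⁻ˡ a px ∷ Unique-++⁻ˡ a b u

    Unique-swap : (s : List A) {x y : A} {w : List A} → Unique (s ++ x ∷ y ∷ w) → Unique (s ++ y ∷ x ∷ w)
    Unique-swap []      ((x≢y ∷ px) ∷ (py ∷ u)) = ((λ y≡x → x≢y (sym y≡x)) ∷ py) ∷ (px ∷ u)
    Unique-swap (z ∷ s) (pz ∷ u)               = All-swap s pz ∷ Unique-swap s u
      where
      All-swap : ∀ {P : A → Set} (s : List A) {x y w} → All P (s ++ x ∷ y ∷ w) → All P (s ++ y ∷ x ∷ w)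
      All-swap []      (px ∷ py ∷ pw) = py ∷ px ∷ pw
      All-swap (z ∷ s) (pz ∷ ps)      = pz ∷ All-swap s ps

    ++-snoc : (s : List A) (x : A) (l : List A) → s ++ x ∷ l ≡ (s ++ x ∷ []) ++ l
    ++-snoc s x l = sym (Listₚ.++-assoc s (x ∷ []) l)

  module _ {n : ℕ} where

    Unique-snoc⁻ : (s : List (Fin n)) (x : Fin n) → Unique (s ++ x ∷ []) → 𝟙∉ x s ≡ 1
    Unique-snoc⁻ []      x _        = refl
    Unique-snoc⁻ (y ∷ s) x (py ∷ u) with x ≟ y
    ... | yes refl = ⊥-elim (All.lookup py (∈ₚ.∈-++⁺ʳ s (here refl)) refl)
    ... | no _     = Unique-snoc⁻ s x u

    Unique-snoc⁺ : (s : List (Fin n)) (x : Fin n) → Unique s → All (_≢ x) s → Unique (s ++ x ∷ [])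
    Unique-snoc⁺ []      x _        _          = [] ∷ []
    Unique-snoc⁺ (y ∷ s) x (py ∷ u) (y≢x ∷ ps) = Allₚ.++⁺ py (y≢x ∷ []) ∷ Unique-snoc⁺ s x u ps

    𝟙-Unique-snoc : (s : List (Fin n)) (x : Fin n) → 𝟙-Unique (s ++ x ∷ []) ≡ 𝟙-Unique s * 𝟙∉ x s
    𝟙-Unique-snoc s x with UniqueDec.unique? _≟_ s | 𝟙∉-0∨1 x s
    ... | no ¬u | _      = 𝟙-Unique-no (λ u → ¬u (Unique-++⁻ˡ s (x ∷ []) u))
    ... | yes u | inj₁ e = trans (𝟙-Unique-no (λ u′ → ℕₚ.0≢1+n (trans (sym e) (Unique-snoc⁻ s x u′))))
                                 (cong (1 *_) (sym e))
    ... | yes u | inj₂ e = trans (𝟙-Unique-yes (Unique-snoc⁺ s x u (𝟙∉≡1⇒All≢ x s e))) (cong (1 *_) (sym e))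

    𝟙-Unique-dup : (x : Fin n) (l : List (Fin n)) → 𝟙-Unique (x ∷ x ∷ l) ≡ 0
    𝟙-Unique-dup x l = 𝟙-Unique-no {l = x ∷ x ∷ l} (λ { ((x≢x ∷ _) ∷ _) → x≢x refl })

  -- Uniform random arrangements

  ∑-allVecs-suc : ∀ n k (H : Vec (Fin n) (suc k) → ℕ) →
                  ∑ (allVecs n (suc k)) H ≡ ∑[ x < n ] ∑[ ρ ← allVecs n k ] H (x ∷ ρ)
  ∑-allVecs-suc n k H = trans (∑-concatMap (λ x → map (x ∷_) (allVecs n k)) (allFin n) H)
                              (∑-cong (allFin n) (λ x → ∑-map (x ∷_) (allVecs n k) H))

  record Relabelling {n k : ℕ} (f : Vec (Fin n) k → Vec (Fin n) k) : Set where
    field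
      ∑-invariant        : ∀ H → ∑ (allVecs n k) H ≡ ∑[ π ← allVecs n k ] H (f π)
      𝟙-Unique-invariant : ∀ s π → 𝟙-Unique (s ++ toList (f π)) ≡ 𝟙-Unique (s ++ toList π)
  open Relabelling

  relabelling-id : ∀ {n k} → Relabelling {n} {k} id
  relabelling-id = record { ∑-invariant = λ _ → refl ; 𝟙-Unique-invariant = λ _ _ → refl }

  relabelling-∘ : ∀ {n k} {f g : Vec (Fin n) k → Vec (Fin n) k} →
                  Relabelling f → Relabelling g → Relabelling (λ π → f (g π))
  relabelling-∘ {f = f} {g} F G = record
    { ∑-invariant        = λ H → trans (∑-invariant F H) (∑-invariant G (λ π → H (f π)))
    ; 𝟙-Unique-invariant = λ s π → trans (𝟙-Unique-invariant F s (g π)) (𝟙-Unique-invariant G s π)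
    }

  swap₀₁ : ∀ {A : Set} {k} → Vec A (suc (suc k)) → Vec A (suc (suc k))
  swap₀₁ (x ∷ y ∷ w) = y ∷ x ∷ w

  relabelling-swap₀₁ : ∀ {n k} → Relabelling {n} {suc (suc k)} swap₀₁
  relabelling-swap₀₁ {n} {k} = record
    { ∑-invariant        = λ H → begin
        ∑ (allVecs n (suc (suc k))) H
          ≡⟨ ∑-allVecs-suc n (suc k) H ⟩
        ∑[ x < n ] ∑[ ρ ← allVecs n (suc k) ] H (x ∷ ρ)
          ≡⟨ ∑-cong (allFin n) (λ x → ∑-allVecs-suc n k (λ ρ → H (x ∷ ρ))) ⟩
        ∑[ x < n ] ∑[ y < n ] ∑[ w ← allVecs n k ] H (x ∷ y ∷ w)
          ≡⟨ ∑-comm (allFin n) (allFin n) _ ⟩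
        ∑[ y < n ] ∑[ x < n ] ∑[ w ← allVecs n k ] H (x ∷ y ∷ w)
          ≡⟨ sym (∑-cong (allFin n) (λ y → ∑-allVecs-suc n k (λ ρ → H (swap₀₁ (y ∷ ρ))))) ⟩
        ∑[ y < n ] ∑[ ρ ← allVecs n (suc k) ] H (swap₀₁ (y ∷ ρ))
          ≡⟨ sym (∑-allVecs-suc n (suc k) (λ π → H (swap₀₁ π))) ⟩
        ∑[ π ← allVecs n (suc (suc k)) ] H (swap₀₁ π) ∎
    ; 𝟙-Unique-invariant = λ { s (x ∷ y ∷ w) → 𝟙-Unique-cong (Unique-swap s) (Unique-swap s) }
    }
    where open ≡-Reasoning

  liftTail : ∀ {A : Set} {k} → (Vec A k → Vec A k) → Vec A (suc k) → Vec A (suc k)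
  liftTail f (x ∷ ρ) = x ∷ f ρ

  relabelling-liftTail : ∀ {n k} {f : Vec (Fin n) k → Vec (Fin n) k} → Relabelling f → Relabelling (liftTail f)
  relabelling-liftTail {n} {k} {f} F = record
    { ∑-invariant        = λ H →
        trans (∑-allVecs-suc n k H)
              (trans (∑-cong (allFin n) (λ x → ∑-invariant F (λ ρ → H (x ∷ ρ))))
                     (sym (∑-allVecs-suc n k (λ π → H (liftTail f π)))))
    ; 𝟙-Unique-invariant = λ { s (x ∷ ρ) →
        trans (cong 𝟙-Unique (++-snoc s x (toList (f ρ))))
              (trans (𝟙-Unique-invariant F (s ++ x ∷ []) ρ) (cong 𝟙-Unique (sym (++-snoc s x (toList ρ))))) }
    }

  toFront : ∀ {A : Set} {k} → Fin (suc k) → Vec A (suc k) → Vec A (suc k)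
  toFront zero              v = v
  toFront {k = suc k} (suc u) v = swap₀₁ (liftTail (toFront u) v)

  relabelling-toFront : ∀ {n k} (u : Fin (suc k)) → Relabelling {n} (toFront u)
  relabelling-toFront zero              = relabelling-id
  relabelling-toFront {k = suc k} (suc u) =
    relabelling-∘ relabelling-swap₀₁ (relabelling-liftTail (relabelling-toFront u))

  lookup-toFront-zero : ∀ {A : Set} {k} (u : Fin (suc k)) (v : Vec A (suc k)) →
                        lookup (toFront u v) zero ≡ lookup v u
  lookup-toFront-zero zero              v       = refl
  lookup-toFront-zero {k = suc k} (suc u) (x ∷ v) with toFront u v | lookup-toFront-zero u v
  ... | y ∷ w | e = e

  lookup-toFront-suc : ∀ {A : Set} {k} (u : Fin (suc k)) (v : Vec A (suc k)) (p : Fin k) →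
                       lookup (toFront u v) (suc p) ≡ lookup v (punchIn u p)
  lookup-toFront-suc zero              v       p       = refl
  lookup-toFront-suc {k = suc k} (suc u) (x ∷ v) zero    with toFront u v
  ... | y ∷ w = refl
  lookup-toFront-suc {k = suc k} (suc u) (x ∷ v) (suc p) with toFront u v | lookup-toFront-suc u v p
  ... | y ∷ w | e = e

  completions : ∀ {n} (r : ℕ) → List (Fin n) → ℕ
  completions {n} r s = ∑[ ρ ← allVecs n r ] 𝟙-Unique (s ++ toList ρ)

  completions-≡ : ∀ {n} r (s : List (Fin n)) → n ≡ length s + r → completions r s ≡ 𝟙-Unique s * r !
  completions-≡ zero s _ =
    trans (ℕₚ.+-identityʳ _) (trans (cong 𝟙-Unique (Listₚ.++-identityʳ s)) (sym (ℕₚ.*-identityʳ _)))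
  completions-≡ {n} (suc r) s n≡ = begin
    completions (suc r) s
      ≡⟨ ∑-allVecs-suc n r _ ⟩
    ∑[ x < n ] ∑[ ρ ← allVecs n r ] 𝟙-Unique (s ++ x ∷ toList ρ)
      ≡⟨ ∑-cong (allFin n) (λ x → ∑-cong (allVecs n r) (λ ρ → cong 𝟙-Unique (++-snoc s x (toList ρ)))) ⟩
    ∑[ x < n ] completions r (s ++ x ∷ [])
      ≡⟨ ∑-cong (allFin n) (λ x → trans (completions-≡ r (s ++ x ∷ []) (n≡′ x)) (cong (_* r !) (𝟙-Unique-snoc s x))) ⟩
    ∑[ x < n ] (𝟙-Unique s * 𝟙∉ x s * r !)
      ≡⟨ ∑-*ʳ (allFin n) (r !) _ ⟩
    ∑[ x < n ] (𝟙-Unique s * 𝟙∉ x s) * r !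
      ≡⟨ cong (_* r !) (trans (∑-*ˡ (allFin n) (𝟙-Unique s) (λ x → 𝟙∉ x s)) free-slots) ⟩
    𝟙-Unique s * suc r * r !
      ≡⟨ ℕₚ.*-assoc (𝟙-Unique s) (suc r) (r !) ⟩
    𝟙-Unique s * suc r ! ∎
    where
    open ≡-Reasoning
    n≡′ : ∀ x → n ≡ length (s ++ x ∷ []) + r
    n≡′ x = trans n≡ (sym (trans (cong (_+ r) (Listₚ.length-++ s)) (ℕₚ.+-assoc (length s) 1 r)))
    free-slots : 𝟙-Unique s * ∑[ x < n ] 𝟙∉ x s ≡ 𝟙-Unique s * suc r
    free-slots with UniqueDec.unique? _≟_ s
    ... | yes u = cong (1 *_) (ℕₚ.+-cancelʳ-≡ (length s) _ _
                    (trans (∑𝟙∉+length n s u) (trans n≡ (ℕₚ.+-comm (length s) (suc r)))))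
    ... | no _  = refl

  ∑-arrangements : ∀ n (g : Vec (Fin n) n → ℕ) →
                   ∑ (arrangements n) g ≡ ∑[ π ← allVecs n n ] (𝟙-Unique (toList π) * g π)
  ∑-arrangements n g = trans (∑-filter (λ π → UniqueDec.unique? _≟_ (toList π)) (allVecs n n) g)
                             (∑-cong (allVecs n n) (λ π → if-Unique (toList π) (g π)))

  length-arrangements : ∀ n → length (arrangements n) ≡ n !
  length-arrangements n = begin
    length (arrangements n)                         ≡⟨ sym (trans (∑-const (arrangements n) 1) (ℕₚ.*-identityʳ _)) ⟩
    ∑[ π ← arrangements n ] 1                       ≡⟨ ∑-arrangements n (λ _ → 1) ⟩
    ∑[ π ← allVecs n n ] (𝟙-Unique (toList π) * 1)  ≡⟨ ∑-cong (allVecs n n) (λ π → ℕₚ.*-identityʳ _) ⟩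
    completions n []                                ≡⟨ completions-≡ n [] refl ⟩
    1 * n !                                         ≡⟨ ℕₚ.*-identityˡ (n !) ⟩
    n !                                             ∎
    where open ≡-Reasoning

  extensionSum : ∀ {n} → ℕ → List (Fin n) → (List (Fin n) → ℕ) → ℕ
  extensionSum         zero    s g = g s
  extensionSum {n = n} (suc j) s g = ∑[ x < n ] extensionSum j (s ++ x ∷ []) g

  extensionSum-cong : ∀ {n} j (s : List (Fin n)) {g g′ : List (Fin n) → ℕ} →
                      (∀ t → length t ≡ length s + j → g t ≡ g′ t) → extensionSum j s g ≡ extensionSum j s g′
  extensionSum-cong zero    s g≗g′ = g≗g′ s (sym (ℕₚ.+-identityʳ (length s)))
  extensionSum-cong {n} (suc j) s g≗g′ = ∑-cong (allFin n) (λ x → extensionSum-cong j (s ++ x ∷ [])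
    (λ t len → g≗g′ t (trans len (trans (cong (_+ j) (Listₚ.length-++ s)) (ℕₚ.+-assoc (length s) 1 j)))))

  extensionSum-*ˡ : ∀ {n} j (s : List (Fin n)) c (g : List (Fin n) → ℕ) →
                    extensionSum j s (λ t → c * g t) ≡ c * extensionSum j s g
  extensionSum-*ˡ zero    s c g = refl
  extensionSum-*ˡ {n} (suc j) s c g =
    trans (∑-cong (allFin n) (λ x → extensionSum-*ˡ j (s ++ x ∷ []) c g)) (∑-*ˡ (allFin n) c _)

  module _ {k : ℕ} (u : Fin (suc k)) where

    punchOutAll : (ws : List (Fin (suc k))) → All (u ≢_) ws → List (Fin k)
    punchOutAll []       []         = []
    punchOutAll (w ∷ ws) (u≢w ∷ ps) = punchOut u≢w ∷ punchOutAll ws ps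

    length-punchOutAll : ∀ ws ps → length (punchOutAll ws ps) ≡ length ws
    length-punchOutAll []       []       = refl
    length-punchOutAll (w ∷ ws) (_ ∷ ps) = cong suc (length-punchOutAll ws ps)

    Unique-punchOutAll : ∀ ws ps → Unique ws → Unique (punchOutAll ws ps)
    Unique-punchOutAll []       []         []         = []
    Unique-punchOutAll (w ∷ ws) (u≢w ∷ ps) (w∉ ∷ uws) = All-punchOut ws ps w∉ ∷ Unique-punchOutAll ws ps uws
      where
      All-punchOut : ∀ ws′ ps′ → All (w ≢_) ws′ → All (punchOut u≢w ≢_) (punchOutAll ws′ ps′)
      All-punchOut []        []          []          = []
      All-punchOut (w′ ∷ ws′) (u≢w′ ∷ ps′) (w≢w′ ∷ as) =
        (λ e → w≢w′ (Finₚ.punchOut-injective u≢w u≢w′ e)) ∷ All-punchOut ws′ ps′ as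

    lookup-punchOutAll : ∀ {A : Set} ws ps (π : Vec A (suc k)) →
                         map (lookup (Vec.tail (toFront u π))) (punchOutAll ws ps) ≡ map (lookup π) ws
    lookup-punchOutAll []       []         π = refl
    lookup-punchOutAll (w ∷ ws) (u≢w ∷ ps) π = cong₂ _∷_
      (trans (lookup-tail (toFront u π) (punchOut u≢w))
             (trans (lookup-toFront-suc u π (punchOut u≢w)) (cong (lookup π) (Finₚ.punchIn-punchOut u≢w))))
      (lookup-punchOutAll ws ps π)
      where
      lookup-tail : ∀ {A : Set} (v : Vec A (suc k)) q → lookup (Vec.tail v) q ≡ lookup v (suc q)
      lookup-tail (x ∷ v) q = refl

  -- Each value of the distinct coordinates ws occurs as often as it has injective completions.
  ∑-lookup-marginal : ∀ {n k} (ws : List (Fin k)) → Unique ws → (r : ℕ) → k ≡ length ws + r →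
    (s : List (Fin n)) (h : List (Fin n) → ℕ) →
    ∑[ π ← allVecs n k ] (𝟙-Unique (s ++ toList π) * h (s ++ map (lookup π) ws))
      ≡ extensionSum (length ws) s (λ t → h t * completions r t)
  ∑-lookup-marginal {n} [] _ r refl s h = begin
    ∑[ π ← allVecs n r ] (𝟙-Unique (s ++ toList π) * h (s ++ []))
      ≡⟨ ∑-*ʳ (allVecs n r) (h (s ++ [])) _ ⟩
    completions r s * h (s ++ [])
      ≡⟨ trans (ℕₚ.*-comm (completions r s) _) (cong (λ t → h t * completions r s) (Listₚ.++-identityʳ s)) ⟩
    h s * completions r s ∎
    where open ≡-Reasoning
  ∑-lookup-marginal {n} {suc k} (u ∷ ws) (u∉ws ∷ uws) r k≡ s h = begin
    ∑[ π ← allVecs n (suc k) ] (𝟙-Unique (s ++ toList π) * h (s ++ lookup π u ∷ map (lookup π) ws))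
      ≡⟨ ∑-cong (allVecs n (suc k)) (λ π → sym (H-toFront π)) ⟩
    ∑[ π ← allVecs n (suc k) ] H (toFront u π)
      ≡⟨ sym (∑-invariant (relabelling-toFront u) H) ⟩
    ∑ (allVecs n (suc k)) H
      ≡⟨ ∑-allVecs-suc n k H ⟩
    ∑[ x < n ] ∑[ ρ ← allVecs n k ] (𝟙-Unique (s ++ x ∷ toList ρ) * h (s ++ x ∷ map (lookup ρ) ws′))
      ≡⟨ ∑-cong (allFin n) (λ x → ∑-cong (allVecs n k) (λ ρ →
           cong₂ (λ a b → 𝟙-Unique a * h b) (++-snoc s x (toList ρ)) (++-snoc s x (map (lookup ρ) ws′)))) ⟩
    ∑[ x < n ] ∑[ ρ ← allVecs n k ] (𝟙-Unique ((s ++ x ∷ []) ++ toList ρ) * h ((s ++ x ∷ []) ++ map (lookup ρ) ws′))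
      ≡⟨ ∑-cong (allFin n) (λ x → ∑-lookup-marginal ws′ (Unique-punchOutAll u ws u∉ws uws) r k≡′ (s ++ x ∷ []) h) ⟩
    extensionSum (suc (length ws′)) s (λ t → h t * completions r t)
      ≡⟨ cong (λ j → extensionSum (suc j) s (λ t → h t * completions r t)) (length-punchOutAll u ws u∉ws) ⟩
    extensionSum (length (u ∷ ws)) s (λ t → h t * completions r t) ∎
    where
    open ≡-Reasoning
    ws′ : List (Fin k)
    ws′ = punchOutAll u ws u∉ws
    k≡′ : k ≡ length ws′ + r
    k≡′ = trans (ℕₚ.suc-injective k≡) (cong (_+ r) (sym (length-punchOutAll u ws u∉ws)))
    H : Vec (Fin n) (suc k) → ℕ
    H ρ = 𝟙-Unique (s ++ toList ρ) * h (s ++ Vec.head ρ ∷ map (lookup (Vec.tail ρ)) ws′)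
    H-toFront : ∀ π → H (toFront u π) ≡ 𝟙-Unique (s ++ toList π) * h (s ++ lookup π u ∷ map (lookup π) ws)
    H-toFront π = cong₂ _*_ (𝟙-Unique-invariant (relabelling-toFront u) s π)
      (cong (λ l → h (s ++ l)) (cong₂ _∷_ (trans (head-lookup (toFront u π)) (lookup-toFront-zero u π))
                                          (lookup-punchOutAll u ws u∉ws π)))
      where
      head-lookup : (v : Vec (Fin n) (suc k)) → Vec.head v ≡ lookup v zero
      head-lookup (x ∷ v) = refl

  injectiveSum : ∀ n → ℕ → (List (Fin n) → ℕ) → ℕ
  injectiveSum n j h = extensionSum j [] (λ t → 𝟙-Unique t * h t)

  ∑-arrangements-lookup : ∀ {n} (ws : List (Fin n)) → Unique ws → (h : List (Fin n) → ℕ) →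
    ∑[ π ← arrangements n ] h (map (lookup π) ws) ≡ (n ∸ length ws) ! * injectiveSum n (length ws) h
  ∑-arrangements-lookup {n} ws uws h = begin
    ∑[ π ← arrangements n ] h (map (lookup π) ws)
      ≡⟨ ∑-arrangements n _ ⟩
    ∑[ π ← allVecs n n ] (𝟙-Unique (toList π) * h (map (lookup π) ws))
      ≡⟨ ∑-lookup-marginal ws uws r n≡ [] h ⟩
    extensionSum (length ws) [] (λ t → h t * completions r t)
      ≡⟨ extensionSum-cong (length ws) [] (λ t len → trans (cong (h t *_) (completions-≡ r t (n≡t t len)))
                                                           (rearrange (h t) (𝟙-Unique t) (r !))) ⟩
    extensionSum (length ws) [] (λ t → r ! * (𝟙-Unique t * h t))
      ≡⟨ extensionSum-*ˡ (length ws) [] (r !) _ ⟩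
    r ! * injectiveSum n (length ws) h ∎
    where
    open ≡-Reasoning
    r : ℕ
    r = n ∸ length ws
    n≡ : n ≡ length ws + r
    n≡ = sym (ℕₚ.m+[n∸m]≡n (Unique⇒length≤ ws uws))
    n≡t : ∀ t → length t ≡ length ws → n ≡ length t + r
    n≡t t len = trans n≡ (cong (_+ r) (sym len))
    rearrange : ∀ a b c → a * (b * c) ≡ c * (b * a)
    rearrange = solve-∀

  -- Pairs of edges

  dist : ∀ {n} → Fin n → Fin n → ℕ
  dist x y = ∣ toℕ x - toℕ y ∣

  dist-comm : ∀ {n} (x y : Fin n) → dist x y ≡ dist y x
  dist-comm x y = ℕₚ.∣-∣-comm (toℕ x) (toℕ y)

  dist-self : ∀ {n} (x : Fin n) → dist x x ≡ 0
  dist-self x = ℕₚ.∣n-n∣≡0 (toℕ x)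

  edgeLength : ∀ {n} → Vec (Fin n) n → Edge n → ℕ
  edgeLength π e = dist (lookup π (proj₁ e)) (lookup π (proj₂ e))

  Ordered : ∀ {n} → Edge n → Set
  Ordered e = toℕ (proj₁ e) < toℕ (proj₂ e)

  Ordered⇒≢ : ∀ {n} {e : Edge n} → Ordered e → proj₁ e ≢ proj₂ e
  Ordered⇒≢ u<v refl = ℕₚ.<-irrefl refl u<v

  incidence : ∀ {n} → Edge n → Edge n → ℕ
  incidence e f = δ (proj₁ e) (proj₁ f) + δ (proj₁ e) (proj₂ f) + δ (proj₂ e) (proj₁ f) + δ (proj₂ e) (proj₂ f)

  incidence-sym : ∀ {n} (e f : Edge n) → incidence e f ≡ incidence f e
  incidence-sym (u , v) (x , y)
    rewrite δ-sym u x | δ-sym u y | δ-sym v x | δ-sym v y = swap-middle (δ x u) (δ y u) (δ x v) (δ y v)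
    where
    swap-middle : ∀ a b c d → a + b + c + d ≡ a + c + b + d
    swap-middle = solve-∀

  incidence-self : ∀ {n} (e : Edge n) → Ordered e → incidence e e ≡ 2
  incidence-self (u , v) u<v = cong₂ _+_ (cong₂ _+_ (cong₂ _+_ (δ-refl u) (δ-≢ (Ordered⇒≢ u<v)))
                                                  (δ-≢ (λ v≡u → Ordered⇒≢ u<v (sym v≡u))))
                                       (δ-refl v)

  pairWeight : ∀ n → Edge n → Edge n → ℕ
  pairWeight n e f = ∑[ π ← arrangements n ] (edgeLength π e * edgeLength π f)

  edgeWeight : ∀ n → Edge n → ℕ
  edgeWeight n e = ∑[ π ← arrangements n ] edgeLength π e

  ∑-D : ∀ n (es : List (Edge n)) → ∑[ π ← arrangements n ] D π es ≡ ∑ es (edgeWeight n)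
  ∑-D n es = ∑-comm (arrangements n) es (λ π → edgeLength π)

  ∑-D² : ∀ n (es : List (Edge n)) →
         ∑[ π ← arrangements n ] (D π es ^ 2) ≡ ∑[ e ← es ] ∑[ f ← es ] pairWeight n e f
  ∑-D² n es = begin
    ∑[ π ← arrangements n ] (D π es ^ 2)
      ≡⟨ ∑-cong (arrangements n) square-expand ⟩
    ∑[ π ← arrangements n ] ∑[ e ← es ] ∑[ f ← es ] (edgeLength π e * edgeLength π f)
      ≡⟨ ∑-comm (arrangements n) es _ ⟩
    ∑[ e ← es ] ∑[ π ← arrangements n ] ∑[ f ← es ] (edgeLength π e * edgeLength π f)
      ≡⟨ ∑-cong es (λ e → ∑-comm (arrangements n) es _) ⟩
    ∑[ e ← es ] ∑[ f ← es ] pairWeight n e f ∎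
    where
    open ≡-Reasoning
    square-expand : ∀ π → D π es ^ 2 ≡ ∑[ e ← es ] ∑[ f ← es ] (edgeLength π e * edgeLength π f)
    square-expand π = begin
      D π es * (D π es * 1)                                ≡⟨ cong (D π es *_) (ℕₚ.*-identityʳ _) ⟩
      ∑ es (edgeLength π) * ∑ es (edgeLength π)            ≡⟨ sym (∑-*ʳ es _ (edgeLength π)) ⟩
      ∑[ e ← es ] (edgeLength π e * ∑ es (edgeLength π))
        ≡⟨ ∑-cong es (λ e → sym (∑-*ˡ es (edgeLength π e) (edgeLength π))) ⟩
      ∑[ e ← es ] ∑[ f ← es ] (edgeLength π e * edgeLength π f) ∎

  module _ {n : ℕ} where

    dist² dist-path dist-disjoint dist₁ : List (Fin n) → ℕ
    dist² (a ∷ b ∷ _) = dist a b * dist a b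
    dist² _           = 0
    dist-path (a ∷ b ∷ c ∷ _) = dist a b * dist b c
    dist-path _               = 0
    dist-disjoint (a ∷ b ∷ c ∷ d ∷ _) = dist a b * dist c d
    dist-disjoint _                   = 0
    dist₁ (a ∷ b ∷ _) = dist a b
    dist₁ _           = 0

  weight₂ weight₁ weight₀ weight-edge : ℕ → ℕ
  weight₂ n = (n ∸ 2) ! * injectiveSum n 2 dist²
  weight₁ n = (n ∸ 3) ! * injectiveSum n 3 dist-path
  weight₀ n = (n ∸ 4) ! * injectiveSum n 4 dist-disjoint
  weight-edge n = (n ∸ 2) ! * injectiveSum n 2 dist₁

  incidenceWeight : ℕ → ℕ → ℕ
  incidenceWeight n 0 = weight₀ n
  incidenceWeight n 1 = weight₁ n
  incidenceWeight n _ = weight₂ n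

  PairClass : ∀ {n} → Edge n → Edge n → Set
  PairClass {n} e f = e ≡ f × incidence e f ≡ 2 × pairWeight n e f ≡ weight₂ n
                    ⊎ incidence e f ≡ 1 × pairWeight n e f ≡ weight₁ n
                    ⊎ incidence e f ≡ 0 × pairWeight n e f ≡ weight₀ n

  classify : ∀ {n} (e f : Edge n) → Ordered e → Ordered f → PairClass e f
  classify {n} (u , v) (x , y) u<v x<y with u ≟ x | u ≟ y | v ≟ x | v ≟ y
  ... | yes refl | yes refl | _        | _        = ⊥-elim (Ordered⇒≢ x<y refl)
  ... | _        | _        | yes refl | yes refl = ⊥-elim (Ordered⇒≢ x<y refl)
  ... | yes refl | _        | yes refl | _        = ⊥-elim (Ordered⇒≢ u<v refl)
  ... | _        | yes refl | _        | yes refl = ⊥-elim (Ordered⇒≢ u<v refl)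
  ... | no _     | yes refl | yes refl | no _     = ⊥-elim (ℕₚ.<-asym u<v x<y)
  ... | yes refl | no u≢y   | no v≢x   | yes refl = inj₁ (refl , refl ,
    (∑-arrangements-lookup (u ∷ v ∷ []) ((Ordered⇒≢ u<v ∷ []) ∷ [] ∷ []) dist²))
  ... | yes refl | no u≢y   | no v≢x   | no v≢y   = inj₂ (inj₁ (refl , trans
    (∑-cong (arrangements n) (λ π → cong (_* dist (lookup π u) (lookup π y)) (dist-comm (lookup π u) (lookup π v))))
    (∑-arrangements-lookup (v ∷ u ∷ y ∷ []) ((v≢x ∷ v≢y ∷ []) ∷ (u≢y ∷ []) ∷ [] ∷ []) dist-path)))
  ... | no u≢x   | yes refl | no v≢x   | no v≢y   = inj₂ (inj₁ (refl , trans
    (∑-cong (arrangements n) (λ π →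
       cong₂ _*_ (dist-comm (lookup π u) (lookup π v)) (dist-comm (lookup π x) (lookup π u))))
    (∑-arrangements-lookup (v ∷ u ∷ x ∷ []) ((v≢y ∷ v≢x ∷ []) ∷ (u≢x ∷ []) ∷ [] ∷ []) dist-path)))
  ... | no u≢x   | no u≢y   | yes refl | no v≢y   = inj₂ (inj₁ (refl ,
    (∑-arrangements-lookup (u ∷ v ∷ y ∷ []) ((u≢x ∷ u≢y ∷ []) ∷ (v≢y ∷ []) ∷ [] ∷ []) dist-path)))
  ... | no u≢x   | no u≢y   | no v≢x   | yes refl = inj₂ (inj₁ (refl , trans
    (∑-cong (arrangements n) (λ π → cong (dist (lookup π u) (lookup π v) *_) (dist-comm (lookup π x) (lookup π v))))
    (∑-arrangements-lookup (u ∷ v ∷ x ∷ []) ((u≢y ∷ u≢x ∷ []) ∷ (v≢x ∷ []) ∷ [] ∷ []) dist-path)))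
  ... | no u≢x   | no u≢y   | no v≢x   | no v≢y   = inj₂ (inj₂ (refl ,
    (∑-arrangements-lookup (u ∷ v ∷ x ∷ y ∷ [])
      ((Ordered⇒≢ u<v ∷ u≢x ∷ u≢y ∷ []) ∷ (v≢x ∷ v≢y ∷ []) ∷ (Ordered⇒≢ x<y ∷ []) ∷ [] ∷ []) dist-disjoint)))

  pairWeight≡incidenceWeight : ∀ {n} (e f : Edge n) → Ordered e → Ordered f →
                               pairWeight n e f ≡ incidenceWeight n (incidence e f)
  pairWeight≡incidenceWeight e f oe of with classify e f oe of
  ... | inj₁ (_ , i , w)      rewrite i = w
  ... | inj₂ (inj₁ (i , w)) rewrite i = w
  ... | inj₂ (inj₂ (i , w)) rewrite i = w

  edgeWeight≡ : ∀ {n} (e : Edge n) → Ordered e → edgeWeight n e ≡ weight-edge n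
  edgeWeight≡ (u , v) u<v = ∑-arrangements-lookup (u ∷ v ∷ []) ((Ordered⇒≢ u<v ∷ []) ∷ [] ∷ []) dist₁

  -- Incidence statistics of edge lists

  incidence-cases : ∀ {n} (e f : Edge n) → Ordered e → Ordered f →
                    incidence e f ≡ 0 ⊎ incidence e f ≡ 1 ⊎ (e ≡ f × incidence e f ≡ 2)
  incidence-cases e f oe of with classify e f oe of
  ... | inj₁ (e≡f , i , _)  = inj₂ (inj₂ (e≡f , i))
  ... | inj₂ (inj₁ (i , _)) = inj₂ (inj₁ i)
  ... | inj₂ (inj₂ (i , _)) = inj₁ i

  incidenceSum : ∀ {n} → (ℕ → ℕ) → List (Edge n) → ℕ
  incidenceSum F es = ∑[ e ← es ] ∑[ f ← es ] F (incidence e f)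

  totalWeight : ∀ n → List (Edge n) → ℕ
  totalWeight n es = incidenceSum (incidenceWeight n) es

  isZero isOne isTwo : ℕ → ℕ
  isZero 0 = 1
  isZero _ = 0
  isOne 1 = 1
  isOne _ = 0
  isTwo 2 = 1
  isTwo _ = 0

  module _ {n : ℕ} (es : List (Edge n)) (ordered : All Ordered es) where

    incidenceSum-cong : {F G : ℕ → ℕ} → (∀ i → i ≤ 2 → F i ≡ G i) → incidenceSum F es ≡ incidenceSum G es
    incidenceSum-cong {F} {G} F≗G =
      ∑-cong-All es ordered (λ e oe → ∑-cong-All es ordered (λ f of → pointwise e f oe of))
      where
      pointwise : ∀ e f → Ordered e → Ordered f → F (incidence e f) ≡ G (incidence e f)
      pointwise e f oe of with incidence-cases e f oe of
      ... | inj₁ i              rewrite i = F≗G 0 z≤n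
      ... | inj₂ (inj₁ i)       rewrite i = F≗G 1 (s≤s z≤n)
      ... | inj₂ (inj₂ (_ , i)) rewrite i = F≗G 2 (s≤s (s≤s z≤n))

    ∑∑pairWeight : ∑[ e ← es ] ∑[ f ← es ] pairWeight n e f ≡ totalWeight n es
    ∑∑pairWeight =
      ∑-cong-All es ordered (λ e oe → ∑-cong-All es ordered (λ f of → pairWeight≡incidenceWeight e f oe of))

  incidenceSum-+ : ∀ {n} (F G : ℕ → ℕ) (es : List (Edge n)) →
                   incidenceSum (λ i → F i + G i) es ≡ incidenceSum F es + incidenceSum G es
  incidenceSum-+ F G es = trans (∑-cong es (λ e → ∑-distrib-+ es _ _)) (∑-distrib-+ es _ _)

  incidenceSum-*ʳ : ∀ {n} (F : ℕ → ℕ) (c : ℕ) (es : List (Edge n)) →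
                    incidenceSum (λ i → F i * c) es ≡ incidenceSum F es * c
  incidenceSum-*ʳ F c es = trans (∑-cong es (λ e → ∑-*ʳ es c _)) (∑-*ʳ es c _)

  module _ {n : ℕ} (es : List (Edge n)) (ordered : All Ordered es) where

    incidenceSum-weights : totalWeight n es
      ≡ incidenceSum isTwo es * weight₂ n + incidenceSum isOne es * weight₁ n + incidenceSum isZero es * weight₀ n
    incidenceSum-weights = begin
      totalWeight n es
        ≡⟨ incidenceSum-cong es ordered split ⟩
      incidenceSum (λ i → isTwo i * weight₂ n + isOne i * weight₁ n + isZero i * weight₀ n) es
        ≡⟨ incidenceSum-+ (λ i → isTwo i * weight₂ n + isOne i * weight₁ n) (λ i → isZero i * weight₀ n) es ⟩
      incidenceSum (λ i → isTwo i * weight₂ n + isOne i * weight₁ n) es + incidenceSum (λ i → isZero i * weight₀ n) es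
        ≡⟨ cong₂ _+_ (trans (incidenceSum-+ (λ i → isTwo i * weight₂ n) (λ i → isOne i * weight₁ n) es)
                            (cong₂ _+_ (incidenceSum-*ʳ isTwo _ es) (incidenceSum-*ʳ isOne _ es)))
                     (incidenceSum-*ʳ isZero _ es) ⟩
      incidenceSum isTwo es * weight₂ n + incidenceSum isOne es * weight₁ n + incidenceSum isZero es * weight₀ n ∎
      where
      open ≡-Reasoning
      split : ∀ i → i ≤ 2 → incidenceWeight n i ≡ isTwo i * weight₂ n + isOne i * weight₁ n + isZero i * weight₀ n
      split 0 _             = sym (ℕₚ.+-identityʳ (weight₀ n))
      split 1 _             = sym (trans (ℕₚ.+-identityʳ _) (ℕₚ.+-identityʳ (weight₁ n)))
      split 2 _             = sym (trans (ℕₚ.+-identityʳ _) (trans (ℕₚ.+-identityʳ _) (ℕₚ.+-identityʳ (weight₂ n))))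
      split (suc (suc (suc _))) (s≤s (s≤s ()))

    incidenceSum-counts : incidenceSum isTwo es + incidenceSum isOne es + incidenceSum isZero es ≡ length es * length es
    incidenceSum-counts = begin
      incidenceSum isTwo es + incidenceSum isOne es + incidenceSum isZero es
        ≡⟨ sym (trans (incidenceSum-+ (λ i → isTwo i + isOne i) isZero es)
                      (cong (_+ incidenceSum isZero es) (incidenceSum-+ isTwo isOne es))) ⟩
      incidenceSum (λ i → isTwo i + isOne i + isZero i) es
        ≡⟨ incidenceSum-cong es ordered partition ⟩
      incidenceSum (λ _ → 1) es
        ≡⟨ trans (∑-cong es (λ e → trans (∑-const es 1) (ℕₚ.*-identityʳ _))) (∑-const es _) ⟩
      length es * length es ∎
      where
      open ≡-Reasoning
      partition : ∀ i → i ≤ 2 → isTwo i + isOne i + isZero i ≡ 1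
      partition 0 _ = refl
      partition 1 _ = refl
      partition 2 _ = refl
      partition (suc (suc (suc _))) (s≤s (s≤s ()))

    incidenceSum-id : incidenceSum id es ≡ incidenceSum isOne es + 2 * incidenceSum isTwo es
    incidenceSum-id = begin
      incidenceSum id es                                      ≡⟨ incidenceSum-cong es ordered value ⟩
      incidenceSum (λ i → isOne i + isTwo i * 2) es           ≡⟨ incidenceSum-+ isOne (λ i → isTwo i * 2) es ⟩
      incidenceSum isOne es + incidenceSum (λ i → isTwo i * 2) es
        ≡⟨ cong (incidenceSum isOne es +_) (trans (incidenceSum-*ʳ isTwo 2 es) (ℕₚ.*-comm (incidenceSum isTwo es) 2)) ⟩
      incidenceSum isOne es + 2 * incidenceSum isTwo es       ∎
      where
      open ≡-Reasoning
      value : ∀ i → i ≤ 2 → i ≡ isOne i + isTwo i * 2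
      value 0 _ = refl
      value 1 _ = refl
      value 2 _ = refl
      value (suc (suc (suc _))) (s≤s (s≤s ()))

  incidenceSum-∷ : ∀ {n} (F : ℕ → ℕ) (a : Edge n) (es : List (Edge n)) →
    incidenceSum F (a ∷ es)
      ≡ F (incidence a a) + ∑[ f ← es ] F (incidence a f) + ∑[ e ← es ] F (incidence e a) + incidenceSum F es
  incidenceSum-∷ F a es =
    trans (cong (F (incidence a a) + ∑[ f ← es ] F (incidence a f) +_) (∑-distrib-+ es _ _))
          (sym (ℕₚ.+-assoc (F (incidence a a) + ∑[ f ← es ] F (incidence a f)) _ _))

  incidenceSum-isTwo : ∀ {n} (es : List (Edge n)) → Unique es → All Ordered es → incidenceSum isTwo es ≡ length es
  incidenceSum-isTwo []       _           _          = refl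
  incidenceSum-isTwo (a ∷ es) (a∉ ∷ uniq) (oa ∷ oes) = trans (incidenceSum-∷ isTwo a es)
    (cong₂ _+_ (cong₂ _+_ (cong₂ _+_ (cong isTwo (incidence-self a oa)) (row es a∉ oes)) (column es a∉ oes))
               (incidenceSum-isTwo es uniq oes))
    where
    isTwo≡0 : ∀ e f → Ordered e → Ordered f → e ≢ f → isTwo (incidence e f) ≡ 0
    isTwo≡0 e f oe of e≢f with incidence-cases e f oe of
    ... | inj₁ i              rewrite i = refl
    ... | inj₂ (inj₁ i)       rewrite i = refl
    ... | inj₂ (inj₂ (e≡f , _)) = ⊥-elim (e≢f e≡f)
    row : ∀ fs → All (a ≢_) fs → All Ordered fs → ∑[ f ← fs ] isTwo (incidence a f) ≡ 0
    row []       []           []          = refl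
    row (f ∷ fs) (a≢f ∷ ps)   (of ∷ ofs)  = cong₂ _+_ (isTwo≡0 a f oa of a≢f) (row fs ps ofs)
    column : ∀ fs → All (a ≢_) fs → All Ordered fs → ∑[ e ← fs ] isTwo (incidence e a) ≡ 0
    column []       []         []         = refl
    column (f ∷ fs) (a≢f ∷ ps) (of ∷ ofs) = cong₂ _+_ (isTwo≡0 f a of oa (λ f≡a → a≢f (sym f≡a))) (column fs ps ofs)

  incident : ∀ {n} → Fin n → Edge n → ℕ
  incident v e = δ v (proj₁ e) + δ v (proj₂ e)

  degree : ∀ {n} → List (Edge n) → Fin n → ℕ
  degree es v = ∑ es (incident v)

  ∑-incident* : ∀ {n} (e f : Edge n) → ∑[ v < n ] (incident v e * incident v f) ≡ incidence e f
  ∑-incident* {n} (u , w) (x , y) = begin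
    ∑[ v < n ] ((δ v u + δ v w) * (δ v x + δ v y))
      ≡⟨ ∑-cong (allFin n) (λ v → expand (δ v u) (δ v w) (δ v x) (δ v y)) ⟩
    ∑[ v < n ] (δ v u * δ v x + δ v u * δ v y + δ v w * δ v x + δ v w * δ v y)
      ≡⟨ trans (∑-distrib-+ (allFin n) _ _)
               (cong (_+ _) (trans (∑-distrib-+ (allFin n) _ _) (cong (_+ _) (∑-distrib-+ (allFin n) _ _)))) ⟩
    ∑[ v < n ] (δ v u * δ v x) + ∑[ v < n ] (δ v u * δ v y) + ∑[ v < n ] (δ v w * δ v x) + ∑[ v < n ] (δ v w * δ v y)
      ≡⟨ cong₂ _+_ (cong₂ _+_ (cong₂ _+_ (∑δ* n u (λ v → δ v x)) (∑δ* n u (λ v → δ v y))) (∑δ* n w (λ v → δ v x)))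
                   (∑δ* n w (λ v → δ v y)) ⟩
    δ u x + δ u y + δ w x + δ w y ∎
    where
    open ≡-Reasoning
    expand : ∀ a b c d → (a + b) * (c + d) ≡ a * c + a * d + b * c + b * d
    expand = solve-∀

  ∑degree² : ∀ n (es : List (Edge n)) → ∑[ v < n ] (degree es v * degree es v) ≡ incidenceSum id es
  ∑degree² n es = begin
    ∑[ v < n ] (∑ es (incident v) * ∑ es (incident v))
      ≡⟨ ∑-cong (allFin n) (λ v → trans (sym (∑-*ʳ es _ (incident v)))
                                          (∑-cong es (λ e → sym (∑-*ˡ es (incident v e) (incident v))))) ⟩
    ∑[ v < n ] ∑[ e ← es ] ∑[ f ← es ] (incident v e * incident v f)
      ≡⟨ ∑-comm (allFin n) es _ ⟩
    ∑[ e ← es ] ∑[ v < n ] ∑[ f ← es ] (incident v e * incident v f)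
      ≡⟨ ∑-cong es (λ e → ∑-comm (allFin n) es _) ⟩
    ∑[ e ← es ] ∑[ f ← es ] ∑[ v < n ] (incident v e * incident v f)
      ≡⟨ ∑-cong es (λ e → ∑-cong es (∑-incident* e)) ⟩
    incidenceSum id es ∎
    where open ≡-Reasoning

  ∑degree : ∀ n (es : List (Edge n)) → ∑[ v < n ] degree es v ≡ 2 * length es
  ∑degree n es = begin
    ∑[ v < n ] ∑[ e ← es ] incident v e
      ≡⟨ ∑-comm (allFin n) es (λ v e → incident v e) ⟩
    ∑[ e ← es ] ∑[ v < n ] incident v e
      ≡⟨ ∑-cong es (λ e → trans (∑-distrib-+ (allFin n) _ _) (cong₂ _+_ (∑δ≡1 n (proj₁ e)) (∑δ≡1 n (proj₂ e)))) ⟩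
    ∑[ e ← es ] 2
      ≡⟨ trans (∑-const es 2) (ℕₚ.*-comm (length es) 2) ⟩
    2 * length es ∎
    where open ≡-Reasoning

  incident-fst : ∀ {n} (a x : Fin n) → 1 ≤ incident a (a , x)
  incident-fst a x = subst (λ d → 1 ≤ d + δ a x) (sym (δ-refl a)) (s≤s z≤n)

  incident-snd : ∀ {n} (a x : Fin n) → 1 ≤ incident a (x , a)
  incident-snd a x = subst (λ d → 1 ≤ δ a x + d) (sym (δ-refl a)) (ℕₚ.m≤n+m 1 (δ a x))

  Connected⇒degree≥1 : ∀ k (es : List (Edge (suc (suc k)))) → Connected es → ∀ v → 1 ≤ degree es v
  Connected⇒degree≥1 k es connected v = reach⇒degree≥1 (connected v w) v≢w
    where
    w : Fin (suc (suc k))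
    w with v ≟ zero
    ... | yes _ = suc zero
    ... | no _  = zero
    v≢w : v ≢ w
    v≢w with v ≟ zero
    ... | yes refl = λ ()
    ... | no v≢0   = v≢0
    reach⇒degree≥1 : ∀ {a b} → Reach es a b → a ≢ b → 1 ≤ degree es a
    reach⇒degree≥1 here       a≢a = ⊥-elim (a≢a refl)
    reach⇒degree≥1 {a} (fwd e∈ _) _ = ℕₚ.≤-trans (incident-fst a _) (∈⇒≤∑ es (incident a) e∈)
    reach⇒degree≥1 {a} (bwd e∈ _) _ = ℕₚ.≤-trans (incident-snd a _) (∈⇒≤∑ es (incident a) e∈)

  -- Since (d - 1)(d - 2) ≥ 0.
  3d≤d²+2 : ∀ d → 1 ≤ d → 3 * d ≤ d * d + 2
  3d≤d²+2 (suc zero)    _ = ℕₚ.≤-refl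
  3d≤d²+2 (suc (suc k)) _ = subst (3 * suc (suc k) ≤_) (sym (expand k)) (ℕₚ.m≤m+n _ _)
    where
    expand : ∀ k → suc (suc k) * suc (suc k) + 2 ≡ 3 * suc (suc k) + (k + 1) * k
    expand = solve-∀

  tree-isOne≥ : ∀ k (es : List (Edge (suc (suc k)))) → Unique es → All Ordered es → Connected es →
                length es ≡ suc k → 2 * k ≤ incidenceSum isOne es
  tree-isOne≥ k es uniq ordered connected len =
    ℕₚ.+-cancelˡ-≤ (4 * k + 6) (2 * k) (incidenceSum isOne es) (subst₂ _≤_ lhs rhs ∑3d≤∑d²+2)
    where
    n : ℕ
    n = suc (suc k)
    ∑3d≤∑d²+2 : 3 * (2 * length es) ≤ incidenceSum id es + n * 2
    ∑3d≤∑d²+2 = subst₂ _≤_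
      (trans (∑-*ˡ (allFin n) 3 (degree es)) (cong (3 *_) (∑degree n es)))
      (trans (∑-distrib-+ (allFin n) (λ v → degree es v * degree es v) (λ _ → 2))
             (cong₂ _+_ (∑degree² n es) (∑<-const n 2)))
      (∑-mono-≤ (allFin n) (λ v → 3d≤d²+2 (degree es v) (Connected⇒degree≥1 k es connected v)))
    lhs : 3 * (2 * length es) ≡ 4 * k + 6 + 2 * k
    lhs = trans (cong (λ m → 3 * (2 * m)) len) (arith k)
      where
      arith : ∀ k → 3 * (2 * suc k) ≡ 4 * k + 6 + 2 * k
      arith = solve-∀
    rhs : incidenceSum id es + n * 2 ≡ 4 * k + 6 + incidenceSum isOne es
    rhs = begin
      incidenceSum id es + n * 2                                   ≡⟨ cong (_+ n * 2) (incidenceSum-id es ordered) ⟩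
      incidenceSum isOne es + 2 * incidenceSum isTwo es + n * 2
        ≡⟨ cong (λ z → incidenceSum isOne es + 2 * z + n * 2) (trans (incidenceSum-isTwo es uniq ordered) len) ⟩
      incidenceSum isOne es + 2 * suc k + n * 2                    ≡⟨ arith k (incidenceSum isOne es) ⟩
      4 * k + 6 + incidenceSum isOne es                            ∎
      where
      open ≡-Reasoning
      arith : ∀ k x → x + 2 * suc k + suc (suc k) * 2 ≡ 4 * k + 6 + x
      arith = solve-∀

  -- The path and the star

  shiftEdge : ∀ {n} → Edge n → Edge (suc n)
  shiftEdge e = (suc (proj₁ e) , suc (proj₂ e))

  length-pathEdges : ∀ k → length (pathEdges (suc k)) ≡ k
  length-pathEdges zero    = refl
  length-pathEdges (suc k) = cong suc (trans (Listₚ.length-map shiftEdge (pathEdges (suc k))) (length-pathEdges k))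

  pathEdges-ordered : ∀ n → All Ordered (pathEdges n)
  pathEdges-ordered zero          = []
  pathEdges-ordered (suc zero)    = []
  pathEdges-ordered (suc (suc k)) = s≤s z≤n ∷ Allₚ.map⁺ (All.map s≤s (pathEdges-ordered (suc k)))

  length-starEdges : ∀ k → length (starEdges (suc k)) ≡ k
  length-starEdges k = trans (Listₚ.length-map _ (allFin k)) (Listₚ.length-tabulate {n = k} id)

  starEdges-ordered : ∀ k → All Ordered (starEdges (suc k))
  starEdges-ordered k = Allₚ.map⁺ (All.tabulate (λ _ → s≤s z≤n))

  incidenceSum-path : ∀ k (F : ℕ → ℕ) →
    incidenceSum F (pathEdges (suc (suc k))) + k * F 0 ≡ (k + 1) * F 2 + 2 * k * F 1 + k * k * F 0
  incidenceSum-path zero    F = refl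
  incidenceSum-path (suc k) F = begin
    incidenceSum F (a ∷ map shiftEdge es) + suc k * F 0
      ≡⟨ cong (_+ suc k * F 0) (incidenceSum-∷ F a (map shiftEdge es)) ⟩
    F (incidence a a) + ∑[ f ← map shiftEdge es ] F (incidence a f) + ∑[ e ← map shiftEdge es ] F (incidence e a)
      + incidenceSum F (map shiftEdge es) + suc k * F 0
      ≡⟨ cong (_+ suc k * F 0) (cong₂ _+_ (cong₂ _+_ (cong (F 2 +_) row)
               (trans (∑-cong (map shiftEdge es) (λ e → cong F (incidence-sym e a))) row))
               (trans (∑-map shiftEdge es _) (∑-cong es (λ e → ∑-map shiftEdge es _)))) ⟩
    F 2 + (F 1 + k * F 0) + (F 1 + k * F 0) + incidenceSum F es + suc k * F 0
      ≡⟨ rearrange k (F 0) (F 1) (F 2) (incidenceSum F es) ⟩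
    F 2 + 2 * F 1 + (2 * k + 1) * F 0 + (incidenceSum F es + k * F 0)
      ≡⟨ cong (F 2 + 2 * F 1 + (2 * k + 1) * F 0 +_) (incidenceSum-path k F) ⟩
    F 2 + 2 * F 1 + (2 * k + 1) * F 0 + ((k + 1) * F 2 + 2 * k * F 1 + k * k * F 0)
      ≡⟨ collect k (F 0) (F 1) (F 2) ⟩
    (suc k + 1) * F 2 + 2 * suc k * F 1 + suc k * suc k * F 0 ∎
    where
    open ≡-Reasoning
    a : Edge (suc (suc (suc k)))
    a = (zero , suc zero)
    es : List (Edge (suc (suc k)))
    es = pathEdges (suc (suc k))
    -- Only the first shifted edge (1 , 2) meets a, and it meets it once.
    row : ∑[ f ← map shiftEdge es ] F (incidence a f) ≡ F 1 + k * F 0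
    row = trans (∑-map shiftEdge es _)
                (cong (F 1 +_) (trans (∑-map shiftEdge (pathEdges (suc k)) _)
                                      (trans (∑-const (pathEdges (suc k)) (F 0)) (cong (_* F 0) (length-pathEdges k)))))
    rearrange : ∀ k f0 f1 f2 x → f2 + (f1 + k * f0) + (f1 + k * f0) + x + suc k * f0
                               ≡ f2 + 2 * f1 + (2 * k + 1) * f0 + (x + k * f0)
    rearrange = solve-∀
    collect : ∀ k f0 f1 f2 → f2 + 2 * f1 + (2 * k + 1) * f0 + ((k + 1) * f2 + 2 * k * f1 + k * k * f0)
                           ≡ (suc k + 1) * f2 + 2 * suc k * f1 + suc k * suc k * f0
    collect = solve-∀

  incidenceSum-star : ∀ k (F : ℕ → ℕ) → incidenceSum F (starEdges (suc k)) + k * F 1 ≡ k * (k * F 1 + F 2)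
  incidenceSum-star k F = begin
    incidenceSum F (starEdges (suc k)) + k * F 1
      ≡⟨ cong₂ _+_ (trans (∑-map spoke (allFin k) _) (∑-cong (allFin k) (λ i → ∑-map spoke (allFin k) _)))
                   (sym (∑<-const k (F 1))) ⟩
    ∑[ i < k ] ∑[ j < k ] F (suc (δ i j)) + ∑[ i < k ] F 1
      ≡⟨ sym (∑-distrib-+ (allFin k) _ (λ _ → F 1)) ⟩
    ∑[ i < k ] (∑[ j < k ] F (suc (δ i j)) + F 1)
      ≡⟨ ∑-cong (allFin k) row ⟩
    ∑[ i < k ] (k * F 1 + F 2)
      ≡⟨ ∑<-const k _ ⟩
    k * (k * F 1 + F 2) ∎
    where
    open ≡-Reasoning
    spoke : Fin k → Edge (suc k)
    spoke i = (zero , suc i)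
    -- Two spokes share the centre, and also their leaf when they are equal.
    F-δ : ∀ i j → F (suc (δ i j)) + δ j i * F 1 ≡ F 1 + δ j i * F 2
    F-δ i j with δ-0∨1 i j | δ-sym i j
    ... | inj₁ e | s rewrite e | sym s = trans (ℕₚ.+-identityʳ _) (sym (ℕₚ.+-identityʳ _))
    ... | inj₂ e | s rewrite e | sym s = trans (cong (F 2 +_) (ℕₚ.+-identityʳ _))
                                                (trans (ℕₚ.+-comm (F 2) (F 1)) (cong (F 1 +_) (sym (ℕₚ.+-identityʳ _))))
    row : ∀ i → ∑[ j < k ] F (suc (δ i j)) + F 1 ≡ k * F 1 + F 2
    row i = begin
      ∑[ j < k ] F (suc (δ i j)) + F 1
        ≡⟨ cong (∑[ j < k ] F (suc (δ i j)) +_) (sym (∑δ* k i (λ _ → F 1))) ⟩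
      ∑[ j < k ] F (suc (δ i j)) + ∑[ j < k ] (δ j i * F 1)
        ≡⟨ sym (∑-distrib-+ (allFin k) _ _) ⟩
      ∑[ j < k ] (F (suc (δ i j)) + δ j i * F 1)
        ≡⟨ ∑-cong (allFin k) (F-δ i) ⟩
      ∑[ j < k ] (F 1 + δ j i * F 2)
        ≡⟨ ∑-distrib-+ (allFin k) _ _ ⟩
      ∑[ j < k ] F 1 + ∑[ j < k ] (δ j i * F 2)
        ≡⟨ cong₂ _+_ (∑<-const k (F 1)) (∑δ* k i (λ _ → F 2)) ⟩
      k * F 1 + F 2 ∎

  exchange-≤ : ∀ (a b c b′ c′ w₂ w₁ w₀ : ℕ) → w₀ ≤ w₁ → b + c ≡ b′ + c′ → b ≤ b′ →
               a * w₂ + b * w₁ + c * w₀ ≤ a * w₂ + b′ * w₁ + c′ * w₀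
  exchange-≤ a b c b′ c′ w₂ w₁ w₀ w₀≤w₁ b+c≡ b≤b′ with ℕₚ.m≤n⇒∃[o]m+o≡n b≤b′
  ... | d , refl = subst₂ _≤_ (sym split) (sym (distribute′ a b c′ d w₂ w₁ w₀))
                          (ℕₚ.+-monoʳ-≤ (a * w₂ + b * w₁ + c′ * w₀) (ℕₚ.*-monoʳ-≤ d w₀≤w₁))
    where
    c≡ : c ≡ c′ + d
    c≡ = ℕₚ.+-cancelˡ-≡ b c (c′ + d) (trans b+c≡ (shuffle b d c′))
      where
      shuffle : ∀ b d c′ → b + d + c′ ≡ b + (c′ + d)
      shuffle = solve-∀
    distribute : ∀ a b c′ d w₂ w₁ w₀ → a * w₂ + b * w₁ + (c′ + d) * w₀ ≡ a * w₂ + b * w₁ + c′ * w₀ + d * w₀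
    distribute = solve-∀
    distribute′ : ∀ a b c′ d w₂ w₁ w₀ → a * w₂ + (b + d) * w₁ + c′ * w₀ ≡ a * w₂ + b * w₁ + c′ * w₀ + d * w₁
    distribute′ = solve-∀
    split : a * w₂ + b * w₁ + c * w₀ ≡ a * w₂ + b * w₁ + c′ * w₀ + d * w₀
    split = trans (cong (λ x → a * w₂ + b * w₁ + x * w₀) c≡) (distribute a b c′ d w₂ w₁ w₀)

  -- Distance sums

  rowSum : ∀ {n} → Fin n → ℕ
  rowSum {n} x = ∑[ y < n ] dist x y

  sumDist sumDist² sumRowSum² : ℕ → ℕ
  sumDist    n = ∑[ x < n ] rowSum x
  sumDist²   n = ∑[ x < n ] ∑[ y < n ] (dist x y * dist x y)
  sumRowSum² n = ∑[ x < n ] (rowSum x * rowSum x)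

  ∑-zero-pointwise : ∀ n (f : Fin n → ℕ) → (∀ x → f x ≡ 0) → ∑[ x < n ] f x ≡ 0
  ∑-zero-pointwise n f f≗0 = trans (∑-cong (allFin n) f≗0) (∑-zero (allFin n))

  ∑∑dist*ʳ : ∀ n (g : Fin n → ℕ) → ∑[ x < n ] ∑[ y < n ] (dist x y * g y) ≡ ∑[ y < n ] (rowSum y * g y)
  ∑∑dist*ʳ n g = trans (∑-comm (allFin n) (allFin n) (λ x y → dist x y * g y)) (∑-cong (allFin n) (λ y →
    trans (∑-*ʳ (allFin n) (g y) (λ x → dist x y)) (cong (_* g y) (∑-cong (allFin n) (λ x → dist-comm x y)))))

  ∑∑dist*ˡ : ∀ n (g : Fin n → ℕ) → ∑[ x < n ] ∑[ y < n ] (dist x y * g x) ≡ ∑[ x < n ] (rowSum x * g x)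
  ∑∑dist*ˡ n g = ∑-cong (allFin n) (λ x → ∑-*ʳ (allFin n) (g x) (λ y → dist x y))

  ∑-pairs-avoiding : ∀ n (x₀ : Fin n) (f : Fin n → ℕ) → f x₀ ≡ 0 →
                     ∑[ x₁ < n ] (𝟙-Unique (x₀ ∷ x₁ ∷ []) * f x₁) ≡ ∑[ x₁ < n ] f x₁
  ∑-pairs-avoiding n x₀ f f≡0 = begin
    ∑[ x₁ < n ] (𝟙-Unique (x₀ ∷ x₁ ∷ []) * f x₁)
      ≡⟨ ∑-cong (allFin n) (λ x₁ → cong (_* f x₁) (trans (𝟙-Unique-snoc (x₀ ∷ []) x₁) (ℕₚ.*-identityˡ _))) ⟩
    ∑[ x₁ < n ] (𝟙∉ x₁ (x₀ ∷ []) * f x₁)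
      ≡⟨ sym (ℕₚ.+-identityʳ _) ⟩
    ∑[ x₁ < n ] (𝟙∉ x₁ (x₀ ∷ []) * f x₁) + 0
      ≡⟨ cong (∑[ x₁ < n ] (𝟙∉ x₁ (x₀ ∷ []) * f x₁) +_) (sym (trans (ℕₚ.+-identityʳ (f x₀)) f≡0)) ⟩
    ∑[ x₁ < n ] (𝟙∉ x₁ (x₀ ∷ []) * f x₁) + ∑ (x₀ ∷ []) f
      ≡⟨ ∑𝟙∉ n (x₀ ∷ []) ([] ∷ []) f ⟩
    ∑[ x₁ < n ] f x₁ ∎
    where open ≡-Reasoning

  injectiveSum-dist² : ∀ n → injectiveSum n 2 dist² ≡ sumDist² n
  injectiveSum-dist² n = ∑-cong (allFin n) (λ x₀ → ∑-pairs-avoiding n x₀ (λ x₁ → dist x₀ x₁ * dist x₀ x₁)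
                                                                     (cong (λ z → z * z) (dist-self x₀)))

  injectiveSum-dist₁ : ∀ n → injectiveSum n 2 dist₁ ≡ sumDist n
  injectiveSum-dist₁ n = ∑-cong (allFin n) (λ x₀ → ∑-pairs-avoiding n x₀ (dist x₀) (dist-self x₀))

  injectiveSum-dist-path : ∀ n → injectiveSum n 3 dist-path + sumDist² n ≡ sumRowSum² n
  injectiveSum-dist-path n = begin
    injectiveSum n 3 dist-path + sumDist² n
      ≡⟨ sym (∑-distrib-+ (allFin n) _ _) ⟩
    ∑[ x₀ < n ] (∑[ x₁ < n ] triples x₀ x₁ + ∑[ x₁ < n ] (dist x₀ x₁ * dist x₀ x₁))
      ≡⟨ ∑-cong (allFin n) (λ x₀ → trans (sym (∑-distrib-+ (allFin n) _ _))
                                           (∑-cong (allFin n) (λ x₁ → middle x₀ x₁ (x₀ ≟ x₁)))) ⟩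
    ∑[ x₀ < n ] ∑[ x₁ < n ] (dist x₀ x₁ * rowSum x₁)
      ≡⟨ ∑∑dist*ʳ n rowSum ⟩
    sumRowSum² n ∎
    where
    open ≡-Reasoning
    triples : Fin n → Fin n → ℕ
    triples x₀ x₁ = ∑[ x₂ < n ] (𝟙-Unique (x₀ ∷ x₁ ∷ x₂ ∷ []) * (dist x₀ x₁ * dist x₁ x₂))
    middle : ∀ x₀ x₁ → Dec (x₀ ≡ x₁) → triples x₀ x₁ + dist x₀ x₁ * dist x₀ x₁ ≡ dist x₀ x₁ * rowSum x₁
    middle x₀ x₁ (yes refl) = trans
      (cong₂ _+_ (∑-zero-pointwise n _ (λ x₂ → cong (_* (dist x₀ x₀ * dist x₀ x₂)) (𝟙-Unique-dup x₀ (x₂ ∷ []))))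
                 (cong (λ z → z * z) (dist-self x₀)))
      (sym (cong (_* rowSum x₀) (dist-self x₀)))
    middle x₀ x₁ (no x₀≢x₁) = begin
      ∑[ x₂ < n ] (𝟙-Unique (s ++ x₂ ∷ []) * (d * dist x₁ x₂)) + d * d
        ≡⟨ cong (_+ d * d) (∑-cong (allFin n) (λ x₂ →
             trans (cong (_* (d * dist x₁ x₂)) (trans (𝟙-Unique-snoc s x₂) (cong (_* 𝟙∉ x₂ s) (𝟙-Unique-yes s-unique))))
                   (regroup (𝟙∉ x₂ s) d (dist x₁ x₂)))) ⟩
      ∑[ x₂ < n ] (d * (𝟙∉ x₂ s * dist x₁ x₂)) + d * d
        ≡⟨ cong₂ _+_ (∑-*ˡ (allFin n) d _) (cong (d *_) (dist-comm x₀ x₁)) ⟩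
      d * ∑[ x₂ < n ] (𝟙∉ x₂ s * dist x₁ x₂) + d * dist x₁ x₀
        ≡⟨ sym (ℕₚ.*-distribˡ-+ d _ _) ⟩
      d * (∑[ x₂ < n ] (𝟙∉ x₂ s * dist x₁ x₂) + dist x₁ x₀)
        ≡⟨ cong (λ z → d * (∑[ x₂ < n ] (𝟙∉ x₂ s * dist x₁ x₂) + z))
                (sym (trans (cong (dist x₁ x₀ +_) (trans (ℕₚ.+-identityʳ _) (dist-self x₁))) (ℕₚ.+-identityʳ _))) ⟩
      d * (∑[ x₂ < n ] (𝟙∉ x₂ s * dist x₁ x₂) + ∑ s (dist x₁))
        ≡⟨ cong (d *_) (∑𝟙∉ n s s-unique (dist x₁)) ⟩
      d * rowSum x₁ ∎
      where
      d : ℕ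
      d = dist x₀ x₁
      s : List (Fin n)
      s = x₀ ∷ x₁ ∷ []
      s-unique : Unique s
      s-unique = (x₀≢x₁ ∷ []) ∷ [] ∷ []
      regroup : ∀ p q r → 1 * p * (q * r) ≡ q * (p * r)
      regroup = solve-∀

  -- Inclusion–exclusion over the two removed points x₀ and x₁.
  ∑-outside-pair : ∀ n (x₀ x₁ : Fin n) → x₀ ≢ x₁ →
    ∑[ x₂ < n ] ∑[ x₃ < n ] (𝟙-Unique (x₀ ∷ x₁ ∷ x₂ ∷ x₃ ∷ []) * dist x₂ x₃) + 2 * rowSum x₀ + 2 * rowSum x₁
      ≡ sumDist n + 2 * dist x₀ x₁
  ∑-outside-pair n x₀ x₁ x₀≢x₁ = begin
    ∑[ x₂ < n ] ∑[ x₃ < n ] (𝟙-Unique (x₀ ∷ x₁ ∷ x₂ ∷ x₃ ∷ []) * dist x₂ x₃) + 2 * rowSum x₀ + 2 * rowSum x₁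
      ≡⟨ cong (λ z → z + 2 * rowSum x₀ + 2 * rowSum x₁) indicator ⟩
    J + 2 * rowSum x₀ + 2 * rowSum x₁
      ≡⟨ cong₂ (λ p q → J + 2 * p + 2 * q) (sym X₀+d) (sym X₁+d) ⟩
    J + 2 * (X₀ + dist x₀ x₁) + 2 * (X₁ + dist x₀ x₁)
      ≡⟨ regroup J X₀ X₁ (dist x₀ x₁) ⟩
    (J + X₀ + X₁) + (X₀ + dist x₀ x₁ + (X₁ + dist x₀ x₁ + 0)) + 2 * dist x₀ x₁
      ≡⟨ cong₂ (λ p q → p + q + 2 * dist x₀ x₁) J+X₀+X₁ (cong₂ (λ p q → p + (q + 0)) X₀+d X₁+d) ⟩
    Y + (rowSum x₀ + (rowSum x₁ + 0)) + 2 * dist x₀ x₁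
      ≡⟨ cong (_+ 2 * dist x₀ x₁) (∑𝟙∉ n s s-unique rowSum) ⟩
    sumDist n + 2 * dist x₀ x₁ ∎
    where
    open ≡-Reasoning
    s : List (Fin n)
    s = x₀ ∷ x₁ ∷ []
    s-unique : Unique s
    s-unique = (x₀≢x₁ ∷ []) ∷ [] ∷ []
    K : Fin n → ℕ
    K x₂ = ∑[ x₃ < n ] (𝟙∉ x₃ (s ++ x₂ ∷ []) * dist x₂ x₃)
    J X₀ X₁ Y : ℕ
    J  = ∑[ x₂ < n ] (𝟙∉ x₂ s * K x₂)
    X₀ = ∑[ x₂ < n ] (𝟙∉ x₂ s * dist x₂ x₀)
    X₁ = ∑[ x₂ < n ] (𝟙∉ x₂ s * dist x₂ x₁)
    Y  = ∑[ x₂ < n ] (𝟙∉ x₂ s * rowSum x₂)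
    indicator : ∑[ x₂ < n ] ∑[ x₃ < n ] (𝟙-Unique (x₀ ∷ x₁ ∷ x₂ ∷ x₃ ∷ []) * dist x₂ x₃) ≡ J
    indicator = ∑-cong (allFin n) (λ x₂ → trans (∑-cong (allFin n) (λ x₃ → cong (_* dist x₂ x₃)
      (trans (𝟙-Unique-snoc (s ++ x₂ ∷ []) x₃) (cong (_* 𝟙∉ x₃ (s ++ x₂ ∷ []))
        (trans (𝟙-Unique-snoc s x₂) (trans (cong (_* 𝟙∉ x₂ s) (𝟙-Unique-yes s-unique)) (ℕₚ.*-identityˡ _)))))))
      (trans (∑-cong (allFin n) (λ x₃ → ℕₚ.*-assoc (𝟙∉ x₂ s) _ _)) (∑-*ˡ (allFin n) (𝟙∉ x₂ s) _)))
    X₀+d : X₀ + dist x₀ x₁ ≡ rowSum x₀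
    X₀+d = trans (cong (X₀ +_) (sym (cong₂ _+_ (dist-self x₀) (trans (ℕₚ.+-identityʳ _) (dist-comm x₁ x₀)))))
                 (trans (∑𝟙∉ n s s-unique (λ x₂ → dist x₂ x₀)) (∑-cong (allFin n) (λ x → dist-comm x x₀)))
    X₁+d : X₁ + dist x₀ x₁ ≡ rowSum x₁
    X₁+d = trans (cong (X₁ +_) (sym (trans (cong (dist x₀ x₁ +_) (trans (ℕₚ.+-identityʳ _) (dist-self x₁)))
                                           (ℕₚ.+-identityʳ _))))
                 (trans (∑𝟙∉ n s s-unique (λ x₂ → dist x₂ x₁)) (∑-cong (allFin n) (λ x → dist-comm x x₁)))
    pointwise : ∀ x₂ → 𝟙∉ x₂ s * K x₂ + 𝟙∉ x₂ s * dist x₂ x₀ + 𝟙∉ x₂ s * dist x₂ x₁ ≡ 𝟙∉ x₂ s * rowSum x₂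
    pointwise x₂ with 𝟙∉-0∨1 x₂ s
    ... | inj₁ e rewrite e = refl
    ... | inj₂ e rewrite e = trans (unit (K x₂) (dist x₂ x₀) (dist x₂ x₁)) (cong (_+ 0) (trans
          (cong (λ z → K x₂ + (dist x₂ x₀ + (dist x₂ x₁ + z))) (sym (trans (ℕₚ.+-identityʳ _) (dist-self x₂))))
          (∑𝟙∉ n (s ++ x₂ ∷ []) (Unique-snoc⁺ s x₂ s-unique (𝟙∉≡1⇒All≢ x₂ s e)) (dist x₂))))
      where
      unit : ∀ k p q → (k + 0) + (p + 0) + (q + 0) ≡ k + (p + (q + 0)) + 0
      unit = solve-∀
    J+X₀+X₁ : J + X₀ + X₁ ≡ Y
    J+X₀+X₁ = trans (cong (_+ X₁) (sym (∑-distrib-+ (allFin n) _ _)))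
                    (trans (sym (∑-distrib-+ (allFin n) _ _)) (∑-cong (allFin n) pointwise))
    regroup : ∀ J X₀ X₁ d → J + 2 * (X₀ + d) + 2 * (X₁ + d) ≡ J + X₀ + X₁ + (X₀ + d + (X₁ + d + 0)) + 2 * d
    regroup = solve-∀

  injectiveSum-dist-disjoint : ∀ n →
    injectiveSum n 4 dist-disjoint + 4 * sumRowSum² n ≡ sumDist n * sumDist n + 2 * sumDist² n
  injectiveSum-dist-disjoint n = begin
    ∑∑ quadruples + 4 * sumRowSum² n
      ≡⟨ double (∑∑ quadruples) (sumRowSum² n) ⟩
    ∑∑ quadruples + 2 * sumRowSum² n + 2 * sumRowSum² n
      ≡⟨ sym (cong₂ (λ p q → ∑∑ quadruples + 2 * p + 2 * q) (∑∑dist*ˡ n rowSum) (∑∑dist*ʳ n rowSum)) ⟩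
    ∑∑ quadruples + 2 * ∑∑ left + 2 * ∑∑ right
      ≡⟨ sym linear ⟩
    ∑∑ (λ x₀ x₁ → quadruples x₀ x₁ + 2 * left x₀ x₁ + 2 * right x₀ x₁)
      ≡⟨ ∑-cong (allFin n) (λ x₀ → ∑-cong (allFin n) (λ x₁ → pointwise x₀ x₁ (x₀ ≟ x₁))) ⟩
    ∑∑ (λ x₀ x₁ → dist x₀ x₁ * sumDist n + 2 * (dist x₀ x₁ * dist x₀ x₁))
      ≡⟨ ∑∑-+ _ _ ⟩
    ∑∑ (λ x₀ x₁ → dist x₀ x₁ * sumDist n) + ∑∑ (λ x₀ x₁ → 2 * (dist x₀ x₁ * dist x₀ x₁))
      ≡⟨ cong₂ _+_ (trans (∑-cong (allFin n) (λ x₀ → ∑-*ʳ (allFin n) (sumDist n) (dist x₀)))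
                          (∑-*ʳ (allFin n) (sumDist n) rowSum))
                   (∑∑-*ˡ 2 _) ⟩
    sumDist n * sumDist n + 2 * sumDist² n ∎
    where
    open ≡-Reasoning
    ∑∑ : (Fin n → Fin n → ℕ) → ℕ
    ∑∑ g = ∑[ x₀ < n ] ∑[ x₁ < n ] g x₀ x₁
    ∑∑-+ : ∀ g h → ∑∑ (λ x₀ x₁ → g x₀ x₁ + h x₀ x₁) ≡ ∑∑ g + ∑∑ h
    ∑∑-+ g h = trans (∑-cong (allFin n) (λ x₀ → ∑-distrib-+ (allFin n) (g x₀) (h x₀))) (∑-distrib-+ (allFin n) _ _)
    ∑∑-*ˡ : ∀ c g → ∑∑ (λ x₀ x₁ → c * g x₀ x₁) ≡ c * ∑∑ g
    ∑∑-*ˡ c g = trans (∑-cong (allFin n) (λ x₀ → ∑-*ˡ (allFin n) c (g x₀))) (∑-*ˡ (allFin n) c _)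
    quadruples left right : Fin n → Fin n → ℕ
    quadruples x₀ x₁ = ∑[ x₂ < n ] ∑[ x₃ < n ] (𝟙-Unique (x₀ ∷ x₁ ∷ x₂ ∷ x₃ ∷ []) * (dist x₀ x₁ * dist x₂ x₃))
    left  x₀ x₁ = dist x₀ x₁ * rowSum x₀
    right x₀ x₁ = dist x₀ x₁ * rowSum x₁
    linear : ∑∑ (λ x₀ x₁ → quadruples x₀ x₁ + 2 * left x₀ x₁ + 2 * right x₀ x₁)
             ≡ ∑∑ quadruples + 2 * ∑∑ left + 2 * ∑∑ right
    linear = trans (∑∑-+ (λ x₀ x₁ → quadruples x₀ x₁ + 2 * left x₀ x₁) (λ x₀ x₁ → 2 * right x₀ x₁))
                   (cong₂ _+_ (trans (∑∑-+ quadruples (λ x₀ x₁ → 2 * left x₀ x₁)) (cong (∑∑ quadruples +_) (∑∑-*ˡ 2 left)))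
                              (∑∑-*ˡ 2 right))
    double : ∀ c t → c + 4 * t ≡ c + 2 * t + 2 * t
    double = solve-∀
    pointwise : ∀ x₀ x₁ → Dec (x₀ ≡ x₁) →
                quadruples x₀ x₁ + 2 * left x₀ x₁ + 2 * right x₀ x₁
                    ≡ dist x₀ x₁ * sumDist n + 2 * (dist x₀ x₁ * dist x₀ x₁)
    pointwise x₀ x₁ (yes refl) rewrite dist-self x₀ = trans (ℕₚ.+-identityʳ _) (trans (ℕₚ.+-identityʳ _)
      (∑-zero-pointwise n _ (λ x₂ → ∑-zero-pointwise n _ (λ x₃ → ℕₚ.*-zeroʳ (𝟙-Unique (x₀ ∷ x₀ ∷ x₂ ∷ x₃ ∷ []))))))
    pointwise x₀ x₁ (no x₀≢x₁) = begin
      quadruples x₀ x₁ + 2 * (d * rowSum x₀) + 2 * (d * rowSum x₁)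
        ≡⟨ cong (λ z → z + 2 * (d * rowSum x₀) + 2 * (d * rowSum x₁)) factor-d ⟩
      d * I + 2 * (d * rowSum x₀) + 2 * (d * rowSum x₁)
        ≡⟨ distribute d I (rowSum x₀) (rowSum x₁) ⟩
      d * (I + 2 * rowSum x₀ + 2 * rowSum x₁)
        ≡⟨ cong (d *_) (∑-outside-pair n x₀ x₁ x₀≢x₁) ⟩
      d * (sumDist n + 2 * d)
        ≡⟨ distribute′ d (sumDist n) ⟩
      d * sumDist n + 2 * (d * d) ∎
      where
      d : ℕ
      d = dist x₀ x₁
      I : ℕ
      I = ∑[ x₂ < n ] ∑[ x₃ < n ] (𝟙-Unique (x₀ ∷ x₁ ∷ x₂ ∷ x₃ ∷ []) * dist x₂ x₃)
      factor-d : quadruples x₀ x₁ ≡ d * I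
      factor-d = trans (∑-cong (allFin n) (λ x₂ →
                         trans (∑-cong (allFin n) (λ x₃ → swap-factor (𝟙-Unique (x₀ ∷ x₁ ∷ x₂ ∷ x₃ ∷ [])) d (dist x₂ x₃)))
                               (∑-*ˡ (allFin n) d _)))
                       (∑-*ˡ (allFin n) d _)
        where
        swap-factor : ∀ a b c → a * (b * c) ≡ b * (a * c)
        swap-factor = solve-∀
      distribute : ∀ d i a b → d * i + 2 * (d * a) + 2 * (d * b) ≡ d * (i + 2 * a + 2 * b)
      distribute = solve-∀
      distribute′ : ∀ d s → d * (s + 2 * d) ≡ d * s + 2 * (d * d)
      distribute′ = solve-∀

  ∑range : ℕ → (ℕ → ℕ) → ℕ
  ∑range m f = ∑[ y < m ] f (toℕ y)

  ∑range-suc : ∀ m f → ∑range (suc m) f ≡ f 0 + ∑range m (λ y → f (suc y))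
  ∑range-suc m f = ∑<-suc m (λ y → f (toℕ y))

  ∑range-snoc : ∀ m f → ∑range (suc m) f ≡ ∑range m f + f m
  ∑range-snoc zero    f = ℕₚ.+-identityʳ (f 0)
  ∑range-snoc (suc m) f = begin
    ∑range (suc (suc m)) f                                ≡⟨ ∑range-suc (suc m) f ⟩
    f 0 + ∑range (suc m) (λ y → f (suc y))                ≡⟨ cong (f 0 +_) (∑range-snoc m (λ y → f (suc y))) ⟩
    f 0 + (∑range m (λ y → f (suc y)) + f (suc m))        ≡⟨ sym (ℕₚ.+-assoc (f 0) _ _) ⟩
    f 0 + ∑range m (λ y → f (suc y)) + f (suc m)          ≡⟨ cong (_+ f (suc m)) (sym (∑range-suc m f)) ⟩
    ∑range (suc m) f + f (suc m)                          ∎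
    where open ≡-Reasoning

  ∑range-+ : ∀ a b f → ∑range (a + b) f ≡ ∑range a f + ∑range b (λ j → f (a + j))
  ∑range-+ zero    b f = refl
  ∑range-+ (suc a) b f = begin
    ∑range (suc a + b) f
      ≡⟨ ∑range-suc (a + b) f ⟩
    f 0 + ∑range (a + b) (λ y → f (suc y))
      ≡⟨ cong (f 0 +_) (∑range-+ a b (λ y → f (suc y))) ⟩
    f 0 + (∑range a (λ y → f (suc y)) + ∑range b (λ j → f (suc a + j)))
      ≡⟨ sym (ℕₚ.+-assoc (f 0) _ _) ⟩
    f 0 + ∑range a (λ y → f (suc y)) + ∑range b (λ j → f (suc a + j))
      ≡⟨ cong (_+ ∑range b (λ j → f (suc a + j))) (sym (∑range-suc a f)) ⟩
    ∑range (suc a) f + ∑range b (λ j → f (suc a + j)) ∎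
    where open ≡-Reasoning

  2∑range-distance-below : ∀ t → 2 * ∑range t (λ y → ∣ t - y ∣) ≡ t * suc t
  2∑range-distance-below zero    = refl
  2∑range-distance-below (suc t) = begin
    2 * ∑range (suc t) (λ y → ∣ suc t - y ∣)   ≡⟨ cong (2 *_) (∑range-suc t (λ y → ∣ suc t - y ∣)) ⟩
    2 * (suc t + ∑range t (λ y → ∣ t - y ∣))   ≡⟨ ℕₚ.*-distribˡ-+ 2 (suc t) (∑range t (λ y → ∣ t - y ∣)) ⟩
    2 * suc t + 2 * ∑range t (λ y → ∣ t - y ∣) ≡⟨ cong (2 * suc t +_) (2∑range-distance-below t) ⟩
    2 * suc t + t * suc t                      ≡⟨ arith t ⟩
    suc t * suc (suc t)                        ∎
    where
    open ≡-Reasoning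
    arith : ∀ t → 2 * suc t + t * suc t ≡ suc t * suc (suc t)
    arith = solve-∀

  2∑range-id : ∀ q → 2 * ∑range (suc q) (λ j → j) ≡ q * suc q
  2∑range-id zero    = refl
  2∑range-id (suc q) = begin
    2 * ∑range (suc (suc q)) (λ j → j)          ≡⟨ cong (2 *_) (∑range-snoc (suc q) (λ j → j)) ⟩
    2 * (∑range (suc q) (λ j → j) + suc q)      ≡⟨ ℕₚ.*-distribˡ-+ 2 (∑range (suc q) (λ j → j)) (suc q) ⟩
    2 * ∑range (suc q) (λ j → j) + 2 * suc q    ≡⟨ cong (_+ 2 * suc q) (2∑range-id q) ⟩
    q * suc q + 2 * suc q                       ≡⟨ arith q ⟩
    suc q * suc (suc q)                         ∎
    where
    open ≡-Reasoning
    arith : ∀ q → q * suc q + 2 * suc q ≡ suc q * suc (suc q)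
    arith = solve-∀

  -- rowSum x unfolds to distanceSum n (toℕ x).
  distanceSum : ℕ → ℕ → ℕ
  distanceSum n t = ∑range n (λ y → ∣ t - y ∣)

  -- The point t has the distances 1, …, t to its left and 0, …, q to its right.
  2*distanceSum : ∀ t q → 2 * distanceSum (t + suc q) t ≡ t * suc t + q * suc q
  2*distanceSum t q = begin
    2 * ∑range (t + suc q) (λ y → ∣ t - y ∣)
      ≡⟨ cong (2 *_) (∑range-+ t (suc q) (λ y → ∣ t - y ∣)) ⟩
    2 * (∑range t (λ y → ∣ t - y ∣) + ∑range (suc q) (λ j → ∣ t - t + j ∣))
      ≡⟨ ℕₚ.*-distribˡ-+ 2 (∑range t (λ y → ∣ t - y ∣)) (∑range (suc q) (λ j → ∣ t - t + j ∣)) ⟩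
    2 * ∑range t (λ y → ∣ t - y ∣) + 2 * ∑range (suc q) (λ j → ∣ t - t + j ∣)
      ≡⟨ cong₂ _+_ (2∑range-distance-below t)
                   (trans (cong (2 *_) (∑-cong (allFin (suc q)) (λ j → ℕₚ.∣m-m+n∣≡n t (toℕ j)))) (2∑range-id q)) ⟩
    t * suc t + q * suc q ∎
    where open ≡-Reasoning

  path-total : ∀ r → let n = 4 + r in
    totalWeight n (pathEdges n)
      ≡ (2 + r) ! * ((3 + r) * sumDist² n + 2 * injectiveSum n 3 dist-path + injectiveSum n 4 dist-disjoint)
  path-total r = ℕₚ.+-cancelʳ-≡ ((2 + r) * (r ! * C)) _ _ (begin
    totalWeight n (pathEdges n) + (2 + r) * (r ! * C)
      ≡⟨ incidenceSum-path (2 + r) (incidenceWeight n) ⟩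
    (2 + r + 1) * ((2 + r) ! * injectiveSum n 2 dist²) + 2 * (2 + r) * ((1 + r) ! * B) + (2 + r) * (2 + r) * (r ! * C)
      ≡⟨ cong (λ a → (2 + r + 1) * ((2 + r) ! * a) + 2 * (2 + r) * ((1 + r) ! * B) + (2 + r) * (2 + r) * (r ! * C))
              (injectiveSum-dist² n) ⟩
    (2 + r + 1) * ((2 + r) ! * sumDist² n) + 2 * (2 + r) * ((1 + r) ! * B) + (2 + r) * (2 + r) * (r ! * C)
      ≡⟨ factor r (r !) (sumDist² n) B C ⟩
    (2 + r) ! * ((3 + r) * sumDist² n + 2 * B + C) + (2 + r) * (r ! * C) ∎)
    where
    open ≡-Reasoning
    n : ℕ
    n = 4 + r
    B : ℕ
    B = injectiveSum n 3 dist-path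
    C : ℕ
    C = injectiveSum n 4 dist-disjoint
    factor : ∀ r f S B C →
      (2 + r + 1) * ((2 + r) * ((1 + r) * f) * S) + 2 * (2 + r) * ((1 + r) * f * B) + (2 + r) * (2 + r) * (f * C)
        ≡ (2 + r) * ((1 + r) * f) * ((3 + r) * S + 2 * B + C) + (2 + r) * (f * C)
    factor = solve-∀

  star-total : ∀ r → let n = 4 + r in
    totalWeight n (starEdges n) ≡ (2 + r) ! * ((3 + r) * sumRowSum² n)
  star-total r = ℕₚ.+-cancelʳ-≡ ((3 + r) * ((1 + r) ! * B)) _ _ (begin
    totalWeight n (starEdges n) + (3 + r) * ((1 + r) ! * B)
      ≡⟨ incidenceSum-star (3 + r) (incidenceWeight n) ⟩
    (3 + r) * ((3 + r) * ((1 + r) ! * B) + (2 + r) ! * injectiveSum n 2 dist²)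
      ≡⟨ cong (λ a → (3 + r) * ((3 + r) * ((1 + r) ! * B) + (2 + r) ! * a)) (injectiveSum-dist² n) ⟩
    (3 + r) * ((3 + r) * ((1 + r) ! * B) + (2 + r) ! * sumDist² n)
      ≡⟨ factor r (r !) (sumDist² n) B ⟩
    (2 + r) ! * ((3 + r) * (B + sumDist² n)) + (3 + r) * ((1 + r) ! * B)
      ≡⟨ cong (λ t → (2 + r) ! * ((3 + r) * t) + (3 + r) * ((1 + r) ! * B)) (injectiveSum-dist-path n) ⟩
    (2 + r) ! * ((3 + r) * sumRowSum² n) + (3 + r) * ((1 + r) ! * B) ∎)
    where
    open ≡-Reasoning
    n : ℕ
    n = 4 + r
    B : ℕ
    B = injectiveSum n 3 dist-path
    factor : ∀ r f S B →
      (3 + r) * ((3 + r) * ((1 + r) * f * B) + (2 + r) * ((1 + r) * f) * S)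
        ≡ (2 + r) * ((1 + r) * f) * ((3 + r) * (B + S)) + (3 + r) * ((1 + r) * f * B)
    factor = solve-∀

  ∑-edgeWeight : ∀ {n} (es : List (Edge n)) → All Ordered es → ∑ es (edgeWeight n) ≡ length es * weight-edge n
  ∑-edgeWeight {n} es ordered =
    trans (∑-cong-All es ordered (λ e oe → edgeWeight≡ e oe)) (∑-const es (weight-edge n))

module ClosedForms where

  open import Defs
  open import Data.Nat as ℕ using (ℕ; zero; suc; _+_; _*_; _∸_; _≤_; _<_; z≤n; ∣_-_∣; _^_; _!)
  import Data.Nat.Properties as ℕₚ
  open import Data.Nat.ListAction using (sum)
  open import Data.Fin using (Fin)
  open import Data.List using (List; map; length; allFin)
  import Data.List.Properties as Listₚ
  open import Data.List.Relation.Unary.All using (All)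
  open import Data.Vec using (Vec)
  open import Data.Product using (_,_; proj₁; proj₂)
  open import Data.Sum using (inj₁; inj₂)
  open import Relation.Binary.PropositionalEquality
    using (_≡_; refl; sym; trans; cong; cong₂; subst; subst₂; module ≡-Reasoning)
  open import Data.Nat.Tactic.RingSolver using (solve-∀)
  open import Data.Integer as ℤ using (ℤ; +_; -_) renaming (_+_ to _+ᶻ_; _*_ to _*ᶻ_; _-_ to _-ᶻ_)
  import Data.Integer.Properties as ℤₚ
  open import Data.Integer.Tactic.RingSolver renaming (solve-∀ to ℤ-solve-∀)
  open import Data.Rational as ℚ using (ℚ)
  import Data.Rational.Properties as ℚₚ
  open import Data.Rational.Unnormalised as ℚᵘ using (ℚᵘ; mkℚᵘ; *≡*; *≤*)
  import Data.Rational.Unnormalised.Properties as ℚᵘₚ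
  open Combinatorics

  ∑ᶻ : ℕ → (ℕ → ℤ) → ℤ
  ∑ᶻ zero    g = + 0
  ∑ᶻ (suc m) g = ∑ᶻ m g +ᶻ g m

  ∑ᶻ-cong-< : ∀ m {g h : ℕ → ℤ} → (∀ t → t < m → g t ≡ h t) → ∑ᶻ m g ≡ ∑ᶻ m h
  ∑ᶻ-cong-< zero    g≗h = refl
  ∑ᶻ-cong-< (suc m) g≗h = cong₂ _+ᶻ_ (∑ᶻ-cong-< m (λ t t<m → g≗h t (ℕₚ.m<n⇒m<1+n t<m))) (g≗h m ℕₚ.≤-refl)

  ∑ᶻ-*ˡ : ∀ m c g → ∑ᶻ m (λ t → c *ᶻ g t) ≡ c *ᶻ ∑ᶻ m g
  ∑ᶻ-*ˡ zero    c g = sym (ℤₚ.*-zeroʳ c)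
  ∑ᶻ-*ˡ (suc m) c g = trans (cong (_+ᶻ c *ᶻ g m) (∑ᶻ-*ˡ m c g)) (sym (ℤₚ.*-distribˡ-+ c (∑ᶻ m g) (g m)))

  +∑range : ∀ m f {g : ℕ → ℤ} → (∀ t → t < m → + f t ≡ g t) → + ∑range m f ≡ ∑ᶻ m g
  +∑range zero    f f≗g = refl
  +∑range (suc m) f f≗g = begin
    + ∑range (suc m) f          ≡⟨ cong +_ (∑range-snoc m f) ⟩
    + (∑range m f + f m)        ≡⟨ ℤₚ.pos-+ (∑range m f) (f m) ⟩
    + ∑range m f +ᶻ + f m       ≡⟨ cong₂ _+ᶻ_ (+∑range m f (λ t t<m → f≗g t (ℕₚ.m<n⇒m<1+n t<m))) (f≗g m ℕₚ.≤-refl) ⟩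
    ∑ᶻ (suc m) _                ∎
    where open ≡-Reasoning

  quartic : ℤ → ℤ → ℤ → ℤ → ℤ → ℤ → ℤ
  quartic c₄ c₃ c₂ c₁ c₀ x = c₄ *ᶻ (x *ᶻ x *ᶻ x *ᶻ x) +ᶻ c₃ *ᶻ (x *ᶻ x *ᶻ x) +ᶻ c₂ *ᶻ (x *ᶻ x) +ᶻ c₁ *ᶻ x +ᶻ c₀

  -- Faulhaber's formulas: sixty times the sum of the quartic over 0 ≤ t < m.
  faulhaber : ℤ → ℤ → ℤ → ℤ → ℤ → ℤ → ℤ
  faulhaber c₄ c₃ c₂ c₁ c₀ m =
    c₄ *ᶻ (+ 2 *ᶻ m *ᶻ (m -ᶻ + 1) *ᶻ (+ 2 *ᶻ m -ᶻ + 1) *ᶻ (+ 3 *ᶻ m *ᶻ m -ᶻ + 3 *ᶻ m -ᶻ + 1))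
        +ᶻ c₃ *ᶻ (+ 15 *ᶻ m *ᶻ m *ᶻ (m -ᶻ + 1) *ᶻ (m -ᶻ + 1))
        +ᶻ c₂ *ᶻ (+ 10 *ᶻ m *ᶻ (m -ᶻ + 1) *ᶻ (+ 2 *ᶻ m -ᶻ + 1)) +ᶻ c₁ *ᶻ (+ 30 *ᶻ m *ᶻ (m -ᶻ + 1)) +ᶻ c₀ *ᶻ (+ 60 *ᶻ m)

  ∑ᶻ-quartic : ∀ c₄ c₃ c₂ c₁ c₀ m → + 60 *ᶻ ∑ᶻ m (λ t → quartic c₄ c₃ c₂ c₁ c₀ (+ t)) ≡ faulhaber c₄ c₃ c₂ c₁ c₀ (+ m)
  ∑ᶻ-quartic c₄ c₃ c₂ c₁ c₀ zero    = at-zero c₄ c₃ c₂ c₁ c₀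
    where
    at-zero : ∀ c₄ c₃ c₂ c₁ c₀ → + 0
        ≡ c₄ *ᶻ (+ 2 *ᶻ (+ 0) *ᶻ ((+ 0) -ᶻ + 1) *ᶻ (+ 2 *ᶻ (+ 0) -ᶻ + 1) *ᶻ (+ 3 *ᶻ (+ 0) *ᶻ (+ 0)
        -ᶻ + 3 *ᶻ (+ 0) -ᶻ + 1)) +ᶻ c₃ *ᶻ (+ 15 *ᶻ (+ 0) *ᶻ (+ 0) *ᶻ ((+ 0) -ᶻ + 1) *ᶻ ((+ 0) -ᶻ + 1))
        +ᶻ c₂ *ᶻ (+ 10 *ᶻ (+ 0) *ᶻ ((+ 0) -ᶻ + 1) *ᶻ (+ 2 *ᶻ (+ 0) -ᶻ + 1))
        +ᶻ c₁ *ᶻ (+ 30 *ᶻ (+ 0) *ᶻ ((+ 0) -ᶻ + 1)) +ᶻ c₀ *ᶻ (+ 60 *ᶻ (+ 0))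
    at-zero = ℤ-solve-∀
  ∑ᶻ-quartic c₄ c₃ c₂ c₁ c₀ (suc m) = begin
    + 60 *ᶻ (∑ᶻ m q +ᶻ q m)
      ≡⟨ ℤₚ.*-distribˡ-+ (+ 60) (∑ᶻ m q) (q m) ⟩
    + 60 *ᶻ ∑ᶻ m q +ᶻ + 60 *ᶻ q m
      ≡⟨ cong (_+ᶻ + 60 *ᶻ q m) (∑ᶻ-quartic c₄ c₃ c₂ c₁ c₀ m) ⟩
    faulhaber c₄ c₃ c₂ c₁ c₀ (+ m) +ᶻ + 60 *ᶻ q m
      ≡⟨ step c₄ c₃ c₂ c₁ c₀ (+ m) ⟩
    faulhaber c₄ c₃ c₂ c₁ c₀ (+ 1 +ᶻ + m)
      ≡⟨ cong (faulhaber c₄ c₃ c₂ c₁ c₀) (sym (ℤₚ.pos-+ 1 m)) ⟩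
    faulhaber c₄ c₃ c₂ c₁ c₀ (+ suc m) ∎
    where
    open ≡-Reasoning
    q : ℕ → ℤ
    q t = quartic c₄ c₃ c₂ c₁ c₀ (+ t)
    step : ∀ c₄ c₃ c₂ c₁ c₀ m →
      c₄ *ᶻ (+ 2 *ᶻ m *ᶻ (m -ᶻ + 1) *ᶻ (+ 2 *ᶻ m -ᶻ + 1) *ᶻ (+ 3 *ᶻ m *ᶻ m -ᶻ + 3 *ᶻ m -ᶻ + 1))
          +ᶻ c₃ *ᶻ (+ 15 *ᶻ m *ᶻ m *ᶻ (m -ᶻ + 1) *ᶻ (m -ᶻ + 1))
          +ᶻ c₂ *ᶻ (+ 10 *ᶻ m *ᶻ (m -ᶻ + 1) *ᶻ (+ 2 *ᶻ m -ᶻ + 1)) +ᶻ c₁ *ᶻ (+ 30 *ᶻ m *ᶻ (m -ᶻ + 1))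
          +ᶻ c₀ *ᶻ (+ 60 *ᶻ m)
        +ᶻ + 60 *ᶻ (c₄ *ᶻ (m *ᶻ m *ᶻ m *ᶻ m) +ᶻ c₃ *ᶻ (m *ᶻ m *ᶻ m) +ᶻ c₂ *ᶻ (m *ᶻ m) +ᶻ c₁ *ᶻ m +ᶻ c₀)
      ≡ c₄ *ᶻ (+ 2 *ᶻ (+ 1 +ᶻ m) *ᶻ ((+ 1 +ᶻ m) -ᶻ + 1) *ᶻ (+ 2 *ᶻ (+ 1 +ᶻ m)
          -ᶻ + 1) *ᶻ (+ 3 *ᶻ (+ 1 +ᶻ m) *ᶻ (+ 1 +ᶻ m) -ᶻ + 3 *ᶻ (+ 1 +ᶻ m) -ᶻ + 1))
          +ᶻ c₃ *ᶻ (+ 15 *ᶻ (+ 1 +ᶻ m) *ᶻ (+ 1 +ᶻ m) *ᶻ ((+ 1 +ᶻ m) -ᶻ + 1) *ᶻ ((+ 1 +ᶻ m) -ᶻ + 1))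
          +ᶻ c₂ *ᶻ (+ 10 *ᶻ (+ 1 +ᶻ m) *ᶻ ((+ 1 +ᶻ m) -ᶻ + 1) *ᶻ (+ 2 *ᶻ (+ 1 +ᶻ m) -ᶻ + 1))
          +ᶻ c₁ *ᶻ (+ 30 *ᶻ (+ 1 +ᶻ m) *ᶻ ((+ 1 +ᶻ m) -ᶻ + 1)) +ᶻ c₀ *ᶻ (+ 60 *ᶻ (+ 1 +ᶻ m))
    step = ℤ-solve-∀

  rowQuadratic : ℕ → ℕ → ℤ
  rowQuadratic n t = quartic (+ 0) (+ 0) (+ 2) (- (+ 2 *ᶻ (+ n -ᶻ + 1))) (+ n *ᶻ + n -ᶻ + n) (+ t)

  2*distanceSum-ℤ : ∀ n t → t < n → + (2 * distanceSum n t) ≡ rowQuadratic n t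
  2*distanceSum-ℤ n t t<n =
    subst (λ n → + (2 * distanceSum n t) ≡ rowQuadratic n t) (trans (ℕₚ.+-suc t q) (ℕₚ.m+[n∸m]≡n t<n)) (begin
      + (2 * distanceSum (t + suc q) t)
        ≡⟨ cong +_ (2*distanceSum t q) ⟩
      + (t * suc t + q * suc q)
        ≡⟨ ℤₚ.pos-+ (t * suc t) (q * suc q) ⟩
      + (t * suc t) +ᶻ + (q * suc q)
        ≡⟨ cong₂ _+ᶻ_ (trans (ℤₚ.pos-* t (suc t)) (cong (+ t *ᶻ_) (ℤₚ.pos-+ 1 t)))
                      (trans (ℤₚ.pos-* q (suc q)) (cong (+ q *ᶻ_) (ℤₚ.pos-+ 1 q))) ⟩
      + t *ᶻ (+ 1 +ᶻ + t) +ᶻ + q *ᶻ (+ 1 +ᶻ + q)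
        ≡⟨ quadratic (+ t) (+ q) ⟩
      quartic (+ 0) (+ 0) (+ 2) (- (+ 2 *ᶻ ((+ t +ᶻ (+ 1 +ᶻ + q)) -ᶻ + 1)))
              ((+ t +ᶻ (+ 1 +ᶻ + q)) *ᶻ (+ t +ᶻ (+ 1 +ᶻ + q)) -ᶻ (+ t +ᶻ (+ 1 +ᶻ + q))) (+ t)
        ≡⟨ cong (λ N → quartic (+ 0) (+ 0) (+ 2) (- (+ 2 *ᶻ (N -ᶻ + 1))) (N *ᶻ N -ᶻ N) (+ t))
                (sym (trans (ℤₚ.pos-+ t (suc q)) (cong (+ t +ᶻ_) (ℤₚ.pos-+ 1 q)))) ⟩
      rowQuadratic (t + suc q) t ∎)
    where
    open ≡-Reasoning
    q : ℕ
    q = n ∸ suc t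
    quadratic : ∀ T Q → T *ᶻ (+ 1 +ᶻ T) +ᶻ Q *ᶻ (+ 1 +ᶻ Q) ≡
      (+ 0) *ᶻ (T *ᶻ T *ᶻ T *ᶻ T) +ᶻ (+ 0) *ᶻ (T *ᶻ T *ᶻ T) +ᶻ (+ 2) *ᶻ (T *ᶻ T)
          +ᶻ (- (+ 2 *ᶻ ((T +ᶻ (+ 1 +ᶻ Q)) -ᶻ + 1))) *ᶻ T
          +ᶻ ((T +ᶻ (+ 1 +ᶻ Q)) *ᶻ (T +ᶻ (+ 1 +ᶻ Q)) -ᶻ (T +ᶻ (+ 1 +ᶻ Q)))
    quadratic = ℤ-solve-∀

  sumDist-closed : ∀ n → + 3 *ᶻ + sumDist n ≡ + n *ᶻ + n *ᶻ + n -ᶻ + n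
  sumDist-closed n = ℤₚ.*-cancelˡ-≡ (+ 40) _ _ (begin
    + 40 *ᶻ (+ 3 *ᶻ + sumDist n)         ≡⟨ regroup (+ sumDist n) ⟩
    + 60 *ᶻ (+ 2 *ᶻ + sumDist n)
        ≡⟨ cong (+ 60 *ᶻ_) (trans (sym (ℤₚ.pos-* 2 (sumDist n))) (cong +_ (sym (∑-*ˡ (allFin n) 2 rowSum)))) ⟩
    + 60 *ᶻ + ∑range n (λ t → 2 * distanceSum n t)
      ≡⟨ cong (+ 60 *ᶻ_) (+∑range n (λ t → 2 * distanceSum n t) (2*distanceSum-ℤ n)) ⟩
    + 60 *ᶻ ∑ᶻ n (rowQuadratic n)
      ≡⟨ ∑ᶻ-quartic (+ 0) (+ 0) (+ 2) (- (+ 2 *ᶻ (+ n -ᶻ + 1))) (+ n *ᶻ + n -ᶻ + n) n ⟩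
    faulhaber (+ 0) (+ 0) (+ 2) (- (+ 2 *ᶻ (+ n -ᶻ + 1))) (+ n *ᶻ + n -ᶻ + n) (+ n)
                                         ≡⟨ evaluate (+ n) ⟩
    + 40 *ᶻ (+ n *ᶻ + n *ᶻ + n -ᶻ + n)  ∎)
    where
    open ≡-Reasoning
    regroup : ∀ s → + 40 *ᶻ (+ 3 *ᶻ s) ≡ + 60 *ᶻ (+ 2 *ᶻ s)
    regroup = ℤ-solve-∀
    evaluate : ∀ N → (+ 0) *ᶻ (+ 2 *ᶻ N *ᶻ (N -ᶻ + 1) *ᶻ (+ 2 *ᶻ N -ᶻ + 1) *ᶻ (+ 3 *ᶻ N *ᶻ N -ᶻ + 3 *ᶻ N
        -ᶻ + 1)) +ᶻ (+ 0) *ᶻ (+ 15 *ᶻ N *ᶻ N *ᶻ (N -ᶻ + 1) *ᶻ (N -ᶻ + 1))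
        +ᶻ (+ 2) *ᶻ (+ 10 *ᶻ N *ᶻ (N -ᶻ + 1) *ᶻ (+ 2 *ᶻ N -ᶻ + 1))
        +ᶻ (- (+ 2 *ᶻ (N -ᶻ + 1))) *ᶻ (+ 30 *ᶻ N *ᶻ (N -ᶻ + 1)) +ᶻ (N *ᶻ N -ᶻ N) *ᶻ (+ 60 *ᶻ N)
        ≡ + 40 *ᶻ (N *ᶻ N *ᶻ N -ᶻ N)
    evaluate = ℤ-solve-∀

  +|t-u|² : ∀ t u → + (∣ t - u ∣ * ∣ t - u ∣) ≡ (+ t -ᶻ + u) *ᶻ (+ t -ᶻ + u)
  +|t-u|² t u with ℕₚ.≤-total t u
  ... | inj₁ t≤u =
    subst (λ u → + (∣ t - u ∣ * ∣ t - u ∣) ≡ (+ t -ᶻ + u) *ᶻ (+ t -ᶻ + u)) (ℕₚ.m+[n∸m]≡n t≤u) (above t (u ∸ t))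
    where
    square : ∀ T K → K *ᶻ K ≡ (T -ᶻ (T +ᶻ K)) *ᶻ (T -ᶻ (T +ᶻ K))
    square = ℤ-solve-∀
    above : ∀ t k → + (∣ t - (t + k) ∣ * ∣ t - (t + k) ∣) ≡ (+ t -ᶻ + (t + k)) *ᶻ (+ t -ᶻ + (t + k))
    above t k rewrite ℕₚ.∣m-m+n∣≡n t k | ℤₚ.pos-+ t k = trans (ℤₚ.pos-* k k) (square (+ t) (+ k))
  ... | inj₂ u≤t =
    subst (λ t → + (∣ t - u ∣ * ∣ t - u ∣) ≡ (+ t -ᶻ + u) *ᶻ (+ t -ᶻ + u)) (ℕₚ.m+[n∸m]≡n u≤t) (below u (t ∸ u))
    where
    square : ∀ U K → K *ᶻ K ≡ ((U +ᶻ K) -ᶻ U) *ᶻ ((U +ᶻ K) -ᶻ U)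
    square = ℤ-solve-∀
    below : ∀ u k → + (∣ (u + k) - u ∣ * ∣ (u + k) - u ∣) ≡ (+ (u + k) -ᶻ + u) *ᶻ (+ (u + k) -ᶻ + u)
    below u k rewrite ℕₚ.∣-∣-comm (u + k) u | ℕₚ.∣m-m+n∣≡n u k | ℤₚ.pos-+ u k =
      trans (ℤₚ.pos-* k k) (square (+ u) (+ k))

  distanceSum² : ℕ → ℕ → ℕ
  distanceSum² n t = ∑range n (λ u → ∣ t - u ∣ * ∣ t - u ∣)

  60*distanceSum² : ∀ n t → + 60 *ᶻ + distanceSum² n t
    ≡ quartic (+ 0) (+ 0) (+ 60 *ᶻ + n) (- (+ 60 *ᶻ + n *ᶻ (+ n -ᶻ + 1)))
              (+ 10 *ᶻ + n *ᶻ (+ n -ᶻ + 1) *ᶻ (+ 2 *ᶻ + n -ᶻ + 1)) (+ t)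
  60*distanceSum² n t = begin
    + 60 *ᶻ + distanceSum² n t
      ≡⟨ cong (+ 60 *ᶻ_) (+∑range n _ (λ u _ → trans (+|t-u|² t u) (expand (+ t) (+ u)))) ⟩
    + 60 *ᶻ ∑ᶻ n (λ u → quartic (+ 0) (+ 0) (+ 1) (- (+ 2 *ᶻ + t)) (+ t *ᶻ + t) (+ u))
      ≡⟨ ∑ᶻ-quartic (+ 0) (+ 0) (+ 1) (- (+ 2 *ᶻ + t)) (+ t *ᶻ + t) n ⟩
    faulhaber (+ 0) (+ 0) (+ 1) (- (+ 2 *ᶻ + t)) (+ t *ᶻ + t) (+ n)
      ≡⟨ collect (+ n) (+ t) ⟩
    quartic (+ 0) (+ 0) (+ 60 *ᶻ + n) (- (+ 60 *ᶻ + n *ᶻ (+ n -ᶻ + 1)))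
            (+ 10 *ᶻ + n *ᶻ (+ n -ᶻ + 1) *ᶻ (+ 2 *ᶻ + n -ᶻ + 1)) (+ t) ∎
    where
    open ≡-Reasoning
    expand : ∀ T U → (T -ᶻ U) *ᶻ (T -ᶻ U) ≡ (+ 0) *ᶻ (U *ᶻ U *ᶻ U *ᶻ U) +ᶻ (+ 0) *ᶻ (U *ᶻ U *ᶻ U)
        +ᶻ (+ 1) *ᶻ (U *ᶻ U) +ᶻ (- (+ 2 *ᶻ T)) *ᶻ U +ᶻ (T *ᶻ T)
    expand = ℤ-solve-∀
    collect : ∀ N T → (+ 0) *ᶻ (+ 2 *ᶻ N *ᶻ (N -ᶻ + 1) *ᶻ (+ 2 *ᶻ N -ᶻ + 1) *ᶻ (+ 3 *ᶻ N *ᶻ N -ᶻ + 3 *ᶻ N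
        -ᶻ + 1)) +ᶻ (+ 0) *ᶻ (+ 15 *ᶻ N *ᶻ N *ᶻ (N -ᶻ + 1) *ᶻ (N -ᶻ + 1))
        +ᶻ (+ 1) *ᶻ (+ 10 *ᶻ N *ᶻ (N -ᶻ + 1) *ᶻ (+ 2 *ᶻ N -ᶻ + 1))
        +ᶻ (- (+ 2 *ᶻ T)) *ᶻ (+ 30 *ᶻ N *ᶻ (N -ᶻ + 1)) +ᶻ (T *ᶻ T) *ᶻ (+ 60 *ᶻ N)
                    ≡ (+ 0) *ᶻ (T *ᶻ T *ᶻ T *ᶻ T) +ᶻ (+ 0) *ᶻ (T *ᶻ T *ᶻ T) +ᶻ (+ 60 *ᶻ N) *ᶻ (T *ᶻ T)
                        +ᶻ (- (+ 60 *ᶻ N *ᶻ (N -ᶻ + 1))) *ᶻ T +ᶻ (+ 10 *ᶻ N *ᶻ (N -ᶻ + 1) *ᶻ (+ 2 *ᶻ N -ᶻ + 1))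
    collect = ℤ-solve-∀

  sumDist²-closed : ∀ n → + 6 *ᶻ + sumDist² n ≡ + n *ᶻ + n *ᶻ + n *ᶻ + n -ᶻ + n *ᶻ + n
  sumDist²-closed n = ℤₚ.*-cancelˡ-≡ (+ 600) _ _ (begin
    + 600 *ᶻ (+ 6 *ᶻ + sumDist² n)
      ≡⟨ regroup (+ sumDist² n) ⟩
    + 60 *ᶻ (+ 60 *ᶻ + ∑range n (distanceSum² n))
      ≡⟨ cong (λ s → + 60 *ᶻ (+ 60 *ᶻ s)) (+∑range n (distanceSum² n) (λ _ _ → refl)) ⟩
    + 60 *ᶻ (+ 60 *ᶻ ∑ᶻ n (λ t → + distanceSum² n t))
      ≡⟨ cong (+ 60 *ᶻ_) (trans (sym (∑ᶻ-*ˡ n (+ 60) _)) (∑ᶻ-cong-< n (λ t _ → 60*distanceSum² n t))) ⟩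
    + 60 *ᶻ ∑ᶻ n (λ t → quartic (+ 0) (+ 0) a₂ a₁ a₀ (+ t))
      ≡⟨ ∑ᶻ-quartic (+ 0) (+ 0) a₂ a₁ a₀ n ⟩
    faulhaber (+ 0) (+ 0) a₂ a₁ a₀ (+ n)
      ≡⟨ evaluate (+ n) ⟩
    + 600 *ᶻ (+ n *ᶻ + n *ᶻ + n *ᶻ + n -ᶻ + n *ᶻ + n) ∎)
    where
    open ≡-Reasoning
    a₂ a₁ a₀ : ℤ
    a₂ = + 60 *ᶻ + n
    a₁ = - (+ 60 *ᶻ + n *ᶻ (+ n -ᶻ + 1))
    a₀ = + 10 *ᶻ + n *ᶻ (+ n -ᶻ + 1) *ᶻ (+ 2 *ᶻ + n -ᶻ + 1)
    regroup : ∀ s → + 600 *ᶻ (+ 6 *ᶻ s) ≡ + 60 *ᶻ (+ 60 *ᶻ s)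
    regroup = ℤ-solve-∀
    evaluate : ∀ N → (+ 0) *ᶻ (+ 2 *ᶻ N *ᶻ (N -ᶻ + 1) *ᶻ (+ 2 *ᶻ N -ᶻ + 1) *ᶻ (+ 3 *ᶻ N *ᶻ N -ᶻ + 3 *ᶻ N
        -ᶻ + 1)) +ᶻ (+ 0) *ᶻ (+ 15 *ᶻ N *ᶻ N *ᶻ (N -ᶻ + 1) *ᶻ (N -ᶻ + 1))
        +ᶻ (+ 60 *ᶻ N) *ᶻ (+ 10 *ᶻ N *ᶻ (N -ᶻ + 1) *ᶻ (+ 2 *ᶻ N -ᶻ + 1))
        +ᶻ (- (+ 60 *ᶻ N *ᶻ (N -ᶻ + 1))) *ᶻ (+ 30 *ᶻ N *ᶻ (N -ᶻ + 1))
        +ᶻ (+ 10 *ᶻ N *ᶻ (N -ᶻ + 1) *ᶻ (+ 2 *ᶻ N -ᶻ + 1)) *ᶻ (+ 60 *ᶻ N)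
                 ≡ + 600 *ᶻ (N *ᶻ N *ᶻ N *ᶻ N -ᶻ N *ᶻ N)
    evaluate = ℤ-solve-∀

  sumRowSum²-closed : ∀ n →
    + 60 *ᶻ + sumRowSum² n ≡ + 7 *ᶻ (+ n *ᶻ + n *ᶻ + n *ᶻ + n *ᶻ + n) -ᶻ + 15 *ᶻ (+ n *ᶻ + n *ᶻ + n) +ᶻ + 8 *ᶻ + n
  sumRowSum²-closed n = ℤₚ.*-cancelˡ-≡ (+ 4) _ _ (begin
    + 4 *ᶻ (+ 60 *ᶻ + sumRowSum² n)
      ≡⟨ regroup (+ sumRowSum² n) ⟩
    + 60 *ᶻ (+ 4 *ᶻ + sumRowSum² n)
      ≡⟨ cong (+ 60 *ᶻ_) (trans (sym (ℤₚ.pos-* 4 (sumRowSum² n)))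
                                (cong +_ (sym (∑-*ˡ (allFin n) 4 (λ x → rowSum x * rowSum x))))) ⟩
    + 60 *ᶻ + ∑range n (λ t → 4 * (distanceSum n t * distanceSum n t))
      ≡⟨ cong (+ 60 *ᶻ_) (+∑range n _ (λ t t<n → trans (+4*square (distanceSum n t))
           (trans (cong (λ z → z *ᶻ z) (2*distanceSum-ℤ n t t<n)) (expand (+ n) (+ t))))) ⟩
    + 60 *ᶻ ∑ᶻ n (λ t → quartic (+ 4) (+ 4 *ᶻ c₁) (c₁ *ᶻ c₁ +ᶻ + 4 *ᶻ c₀) (+ 2 *ᶻ c₁ *ᶻ c₀) (c₀ *ᶻ c₀) (+ t))
      ≡⟨ ∑ᶻ-quartic (+ 4) (+ 4 *ᶻ c₁) (c₁ *ᶻ c₁ +ᶻ + 4 *ᶻ c₀) (+ 2 *ᶻ c₁ *ᶻ c₀) (c₀ *ᶻ c₀) n ⟩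
    faulhaber (+ 4) (+ 4 *ᶻ c₁) (c₁ *ᶻ c₁ +ᶻ + 4 *ᶻ c₀) (+ 2 *ᶻ c₁ *ᶻ c₀) (c₀ *ᶻ c₀) (+ n)
      ≡⟨ evaluate (+ n) ⟩
    + 4 *ᶻ (+ 7 *ᶻ (+ n *ᶻ + n *ᶻ + n *ᶻ + n *ᶻ + n) -ᶻ + 15 *ᶻ (+ n *ᶻ + n *ᶻ + n) +ᶻ + 8 *ᶻ + n) ∎)
    where
    open ≡-Reasoning
    c₁ c₀ : ℤ
    c₁ = - (+ 2 *ᶻ (+ n -ᶻ + 1))
    c₀ = + n *ᶻ + n -ᶻ + n
    regroup : ∀ s → + 4 *ᶻ (+ 60 *ᶻ s) ≡ + 60 *ᶻ (+ 4 *ᶻ s)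
    regroup = ℤ-solve-∀
    +4*square : ∀ a → + (4 * (a * a)) ≡ + (2 * a) *ᶻ + (2 * a)
    +4*square a = trans (ℤₚ.pos-* 4 (a * a)) (trans (cong (+ 4 *ᶻ_) (ℤₚ.pos-* a a))
                    (trans (double (+ a)) (sym (cong₂ _*ᶻ_ (ℤₚ.pos-* 2 a) (ℤₚ.pos-* 2 a)))))
      where
      double : ∀ A → + 4 *ᶻ (A *ᶻ A) ≡ (+ 2 *ᶻ A) *ᶻ (+ 2 *ᶻ A)
      double = ℤ-solve-∀
    expand : ∀ N T → ((+ 0) *ᶻ (T *ᶻ T *ᶻ T *ᶻ T) +ᶻ (+ 0) *ᶻ (T *ᶻ T *ᶻ T) +ᶻ (+ 2) *ᶻ (T *ᶻ T)
        +ᶻ (- (+ 2 *ᶻ (N -ᶻ + 1))) *ᶻ T +ᶻ (N *ᶻ N -ᶻ N)) *ᶻ ((+ 0) *ᶻ (T *ᶻ T *ᶻ T *ᶻ T)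
        +ᶻ (+ 0) *ᶻ (T *ᶻ T *ᶻ T) +ᶻ (+ 2) *ᶻ (T *ᶻ T) +ᶻ (- (+ 2 *ᶻ (N -ᶻ + 1))) *ᶻ T +ᶻ (N *ᶻ N -ᶻ N))
                   ≡ (+ 4) *ᶻ (T *ᶻ T *ᶻ T *ᶻ T) +ᶻ (+ 4 *ᶻ (- (+ 2 *ᶻ (N -ᶻ + 1)))) *ᶻ (T *ᶻ T *ᶻ T)
                       +ᶻ ((- (+ 2 *ᶻ (N -ᶻ + 1))) *ᶻ (- (+ 2 *ᶻ (N -ᶻ + 1)))
                       +ᶻ + 4 *ᶻ (N *ᶻ N -ᶻ N)) *ᶻ (T *ᶻ T)
                       +ᶻ (+ 2 *ᶻ (- (+ 2 *ᶻ (N -ᶻ + 1))) *ᶻ (N *ᶻ N -ᶻ N)) *ᶻ T +ᶻ ((N *ᶻ N -ᶻ N) *ᶻ (N *ᶻ N -ᶻ N))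
    expand = ℤ-solve-∀
    evaluate : ∀ N → (+ 4) *ᶻ (+ 2 *ᶻ N *ᶻ (N -ᶻ + 1) *ᶻ (+ 2 *ᶻ N -ᶻ + 1) *ᶻ (+ 3 *ᶻ N *ᶻ N -ᶻ + 3 *ᶻ N
        -ᶻ + 1)) +ᶻ (+ 4 *ᶻ (- (+ 2 *ᶻ (N -ᶻ + 1)))) *ᶻ (+ 15 *ᶻ N *ᶻ N *ᶻ (N -ᶻ + 1) *ᶻ (N -ᶻ + 1))
        +ᶻ ((- (+ 2 *ᶻ (N -ᶻ + 1))) *ᶻ (- (+ 2 *ᶻ (N -ᶻ + 1)))
        +ᶻ + 4 *ᶻ (N *ᶻ N -ᶻ N)) *ᶻ (+ 10 *ᶻ N *ᶻ (N -ᶻ + 1) *ᶻ (+ 2 *ᶻ N -ᶻ + 1))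
        +ᶻ (+ 2 *ᶻ (- (+ 2 *ᶻ (N -ᶻ + 1))) *ᶻ (N *ᶻ N -ᶻ N)) *ᶻ (+ 30 *ᶻ N *ᶻ (N -ᶻ + 1))
        +ᶻ ((N *ᶻ N -ᶻ N) *ᶻ (N *ᶻ N -ᶻ N)) *ᶻ (+ 60 *ᶻ N)
                 ≡ + 4 *ᶻ (+ 7 *ᶻ (N *ᶻ N *ᶻ N *ᶻ N *ᶻ N) -ᶻ + 15 *ᶻ (N *ᶻ N *ᶻ N) +ᶻ + 8 *ᶻ N)
    evaluate = ℤ-solve-∀

  cong₃ : ∀ {A B C D : Set} (f : A → B → C → D) {a a′ b b′ c c′} → a ≡ a′ → b ≡ b′ → c ≡ c′ → f a b c ≡ f a′ b′ c′
  cong₃ f refl refl refl = refl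

  pathNumerator starNumerator edgeNumerator : ℤ → ℤ
  pathNumerator N = (N +ᶻ + 1) *ᶻ (+ 10 *ᶻ N *ᶻ N *ᶻ N -ᶻ + 6 *ᶻ N *ᶻ N -ᶻ + 25 *ᶻ N +ᶻ + 24)
  starNumerator N = (N +ᶻ + 1) *ᶻ (N -ᶻ + 1) *ᶻ (+ 7 *ᶻ N *ᶻ N -ᶻ + 8)
  edgeNumerator N = (N +ᶻ + 1) *ᶻ (N -ᶻ + 1)

  pathVarianceNumerator starVarianceNumerator : ℤ → ℤ
  pathVarianceNumerator N = (N +ᶻ + 1) *ᶻ (N -ᶻ + 2) *ᶻ (+ 4 *ᶻ N -ᶻ + 7)
  starVarianceNumerator N = (N +ᶻ + 1) *ᶻ (N -ᶻ + 1) *ᶻ (N +ᶻ + 2) *ᶻ (N -ᶻ + 2)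

  module DistanceSumIdentities
    (N s₁ s₂ t b c : ℤ)
    (s₁-closed : + 3 *ᶻ s₁ ≡ N *ᶻ N *ᶻ N -ᶻ N)
    (s₂-closed : + 6 *ᶻ s₂ ≡ N *ᶻ N *ᶻ N *ᶻ N -ᶻ N *ᶻ N)
    (t-closed  : + 60 *ᶻ t ≡ + 7 *ᶻ (N *ᶻ N *ᶻ N *ᶻ N *ᶻ N) -ᶻ + 15 *ᶻ (N *ᶻ N *ᶻ N) +ᶻ + 8 *ᶻ N)
    (b+s₂≡t    : b +ᶻ s₂ ≡ t)
    (c+4t≡     : c +ᶻ + 4 *ᶻ t ≡ s₁ *ᶻ s₁ +ᶻ + 2 *ᶻ s₂)
    where

    path-moment : ((N -ᶻ + 1) *ᶻ s₂ +ᶻ + 2 *ᶻ b +ᶻ c) *ᶻ + 90 ≡ pathNumerator N *ᶻ (N *ᶻ (N -ᶻ + 1))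
    path-moment = ℤₚ.*-cancelˡ-≡ (+ 2) _ _ (begin
      + 2 *ᶻ (((N -ᶻ + 1) *ᶻ s₂ +ᶻ + 2 *ᶻ b +ᶻ c) *ᶻ + 90) ≡⟨ eliminate N s₁ s₂ t b c ⟩
      G₁ (b +ᶻ s₂) (c +ᶻ + 4 *ᶻ t)                          ≡⟨ cong₂ G₁ b+s₂≡t c+4t≡ ⟩
      G₁ t (s₁ *ᶻ s₁ +ᶻ + 2 *ᶻ s₂)                          ≡⟨ regroup N s₁ s₂ t ⟩
      G₂ (+ 3 *ᶻ s₁) (+ 6 *ᶻ s₂) (+ 60 *ᶻ t)                ≡⟨ cong₃ G₂ s₁-closed s₂-closed t-closed ⟩
      G₂ (N *ᶻ N *ᶻ N -ᶻ N) (N *ᶻ N *ᶻ N *ᶻ N -ᶻ N *ᶻ N)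
         (+ 7 *ᶻ (N *ᶻ N *ᶻ N *ᶻ N *ᶻ N) -ᶻ + 15 *ᶻ (N *ᶻ N *ᶻ N) +ᶻ + 8 *ᶻ N) ≡⟨ evaluate N ⟩
      + 2 *ᶻ (pathNumerator N *ᶻ (N *ᶻ (N -ᶻ + 1))) ∎)
      where
      open ≡-Reasoning
      G₁ : ℤ → ℤ → ℤ
      G₁ x y = + 180 *ᶻ (N -ᶻ + 1) *ᶻ s₂ +ᶻ + 360 *ᶻ (x -ᶻ s₂) +ᶻ + 180 *ᶻ (y -ᶻ + 4 *ᶻ t)
      G₂ : ℤ → ℤ → ℤ → ℤ
      G₂ x y z = + 30 *ᶻ (N -ᶻ + 1) *ᶻ y +ᶻ + 20 *ᶻ x *ᶻ x -ᶻ + 6 *ᶻ z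
      eliminate : ∀ N s₁ s₂ t b c → + 2 *ᶻ (((N -ᶻ + 1) *ᶻ s₂ +ᶻ + 2 *ᶻ b +ᶻ c) *ᶻ + 90)
        ≡ + 180 *ᶻ (N -ᶻ + 1) *ᶻ s₂ +ᶻ + 360 *ᶻ ((b +ᶻ s₂) -ᶻ s₂) +ᶻ + 180 *ᶻ ((c +ᶻ + 4 *ᶻ t) -ᶻ + 4 *ᶻ t)
      eliminate = ℤ-solve-∀
      regroup : ∀ N s₁ s₂ t → + 180 *ᶻ (N -ᶻ + 1) *ᶻ s₂ +ᶻ + 360 *ᶻ (t -ᶻ s₂)
          +ᶻ + 180 *ᶻ ((s₁ *ᶻ s₁ +ᶻ + 2 *ᶻ s₂) -ᶻ + 4 *ᶻ t)
        ≡ + 30 *ᶻ (N -ᶻ + 1) *ᶻ (+ 6 *ᶻ s₂) +ᶻ + 20 *ᶻ (+ 3 *ᶻ s₁) *ᶻ (+ 3 *ᶻ s₁) -ᶻ + 6 *ᶻ (+ 60 *ᶻ t)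
      regroup = ℤ-solve-∀
      evaluate : ∀ N → + 30 *ᶻ (N -ᶻ + 1) *ᶻ (N *ᶻ N *ᶻ N *ᶻ N -ᶻ N *ᶻ N)
          +ᶻ + 20 *ᶻ (N *ᶻ N *ᶻ N -ᶻ N) *ᶻ (N *ᶻ N *ᶻ N -ᶻ N)
                       -ᶻ + 6 *ᶻ (+ 7 *ᶻ (N *ᶻ N *ᶻ N *ᶻ N *ᶻ N) -ᶻ + 15 *ᶻ (N *ᶻ N *ᶻ N) +ᶻ + 8 *ᶻ N)
        ≡ + 2 *ᶻ (((N +ᶻ + 1) *ᶻ (+ 10 *ᶻ N *ᶻ N *ᶻ N -ᶻ + 6 *ᶻ N *ᶻ N -ᶻ + 25 *ᶻ N +ᶻ + 24)) *ᶻ (N *ᶻ (N -ᶻ + 1)))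
      evaluate = ℤ-solve-∀

    star-moment : ((N -ᶻ + 1) *ᶻ t) *ᶻ + 60 ≡ starNumerator N *ᶻ (N *ᶻ (N -ᶻ + 1))
    star-moment = begin
      ((N -ᶻ + 1) *ᶻ t) *ᶻ + 60 ≡⟨ regroup N t ⟩
      (N -ᶻ + 1) *ᶻ (+ 60 *ᶻ t) ≡⟨ cong ((N -ᶻ + 1) *ᶻ_) t-closed ⟩
      (N -ᶻ + 1) *ᶻ (+ 7 *ᶻ (N *ᶻ N *ᶻ N *ᶻ N *ᶻ N) -ᶻ + 15 *ᶻ (N *ᶻ N *ᶻ N) +ᶻ + 8 *ᶻ N) ≡⟨ evaluate N ⟩
      starNumerator N *ᶻ (N *ᶻ (N -ᶻ + 1)) ∎
      where
      open ≡-Reasoning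
      regroup : ∀ N t → ((N -ᶻ + 1) *ᶻ t) *ᶻ + 60 ≡ (N -ᶻ + 1) *ᶻ (+ 60 *ᶻ t)
      regroup = ℤ-solve-∀
      evaluate : ∀ N → (N -ᶻ + 1) *ᶻ (+ 7 *ᶻ (N *ᶻ N *ᶻ N *ᶻ N *ᶻ N) -ᶻ + 15 *ᶻ (N *ᶻ N *ᶻ N) +ᶻ + 8 *ᶻ N)
        ≡ ((N +ᶻ + 1) *ᶻ (N -ᶻ + 1) *ᶻ (+ 7 *ᶻ N *ᶻ N -ᶻ + 8)) *ᶻ (N *ᶻ (N -ᶻ + 1))
      evaluate = ℤ-solve-∀

    edge-moment : ((N -ᶻ + 1) *ᶻ s₁) *ᶻ + 3 ≡ edgeNumerator N *ᶻ (N *ᶻ (N -ᶻ + 1))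
    edge-moment = begin
      ((N -ᶻ + 1) *ᶻ s₁) *ᶻ + 3          ≡⟨ regroup N s₁ ⟩
      (N -ᶻ + 1) *ᶻ (+ 3 *ᶻ s₁)          ≡⟨ cong ((N -ᶻ + 1) *ᶻ_) s₁-closed ⟩
      (N -ᶻ + 1) *ᶻ (N *ᶻ N *ᶻ N -ᶻ N)   ≡⟨ evaluate N ⟩
      edgeNumerator N *ᶻ (N *ᶻ (N -ᶻ + 1)) ∎
      where
      open ≡-Reasoning
      regroup : ∀ N s → ((N -ᶻ + 1) *ᶻ s) *ᶻ + 3 ≡ (N -ᶻ + 1) *ᶻ (+ 3 *ᶻ s)
      regroup = ℤ-solve-∀
      evaluate : ∀ N → (N -ᶻ + 1) *ᶻ (N *ᶻ N *ᶻ N -ᶻ N) ≡ ((N +ᶻ + 1) *ᶻ (N -ᶻ + 1)) *ᶻ (N *ᶻ (N -ᶻ + 1))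
      evaluate = ℤ-solve-∀

    adjacent-minus-disjoint : + 180 *ᶻ ((N -ᶻ + 3) *ᶻ b -ᶻ c)
      ≡ N *ᶻ (N +ᶻ + 1) *ᶻ (N -ᶻ + 1) *ᶻ (N -ᶻ + 2) *ᶻ (N -ᶻ + 3) *ᶻ (N -ᶻ + 4)
    adjacent-minus-disjoint = begin
      + 180 *ᶻ ((N -ᶻ + 3) *ᶻ b -ᶻ c)            ≡⟨ eliminate N s₂ t b c ⟩
      G₁ (b +ᶻ s₂) (c +ᶻ + 4 *ᶻ t)               ≡⟨ cong₂ G₁ b+s₂≡t c+4t≡ ⟩
      G₁ t (s₁ *ᶻ s₁ +ᶻ + 2 *ᶻ s₂)               ≡⟨ regroup N s₁ s₂ t ⟩
      G₂ (+ 3 *ᶻ s₁) (+ 6 *ᶻ s₂) (+ 60 *ᶻ t)     ≡⟨ cong₃ G₂ s₁-closed s₂-closed t-closed ⟩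
      G₂ (N *ᶻ N *ᶻ N -ᶻ N) (N *ᶻ N *ᶻ N *ᶻ N -ᶻ N *ᶻ N)
         (+ 7 *ᶻ (N *ᶻ N *ᶻ N *ᶻ N *ᶻ N) -ᶻ + 15 *ᶻ (N *ᶻ N *ᶻ N) +ᶻ + 8 *ᶻ N) ≡⟨ evaluate N ⟩
      N *ᶻ (N +ᶻ + 1) *ᶻ (N -ᶻ + 1) *ᶻ (N -ᶻ + 2) *ᶻ (N -ᶻ + 3) *ᶻ (N -ᶻ + 4) ∎
      where
      open ≡-Reasoning
      G₁ : ℤ → ℤ → ℤ
      G₁ x y = + 180 *ᶻ (N -ᶻ + 3) *ᶻ (x -ᶻ s₂) -ᶻ + 180 *ᶻ (y -ᶻ + 4 *ᶻ t)
      G₂ : ℤ → ℤ → ℤ → ℤ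
      G₂ x y z = + 3 *ᶻ (N -ᶻ + 3) *ᶻ z -ᶻ + 30 *ᶻ (N -ᶻ + 3) *ᶻ y -ᶻ + 20 *ᶻ x *ᶻ x -ᶻ + 60 *ᶻ y +ᶻ + 12 *ᶻ z
      eliminate : ∀ N s₂ t b c → + 180 *ᶻ ((N -ᶻ + 3) *ᶻ b -ᶻ c)
        ≡ + 180 *ᶻ (N -ᶻ + 3) *ᶻ ((b +ᶻ s₂) -ᶻ s₂) -ᶻ + 180 *ᶻ ((c +ᶻ + 4 *ᶻ t) -ᶻ + 4 *ᶻ t)
      eliminate = ℤ-solve-∀
      regroup : ∀ N s₁ s₂ t → + 180 *ᶻ (N -ᶻ + 3) *ᶻ (t -ᶻ s₂) -ᶻ + 180 *ᶻ ((s₁ *ᶻ s₁ +ᶻ + 2 *ᶻ s₂) -ᶻ + 4 *ᶻ t)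
        ≡ + 3 *ᶻ (N -ᶻ + 3) *ᶻ (+ 60 *ᶻ t) -ᶻ + 30 *ᶻ (N -ᶻ + 3) *ᶻ (+ 6 *ᶻ s₂) -ᶻ + 20 *ᶻ (+ 3 *ᶻ s₁) *ᶻ (+ 3 *ᶻ s₁)
          -ᶻ + 60 *ᶻ (+ 6 *ᶻ s₂) +ᶻ + 12 *ᶻ (+ 60 *ᶻ t)
      regroup = ℤ-solve-∀
      evaluate : ∀ N → + 3 *ᶻ (N -ᶻ + 3) *ᶻ (+ 7 *ᶻ (N *ᶻ N *ᶻ N *ᶻ N *ᶻ N) -ᶻ + 15 *ᶻ (N *ᶻ N *ᶻ N) +ᶻ + 8 *ᶻ N)
          -ᶻ + 30 *ᶻ (N -ᶻ + 3) *ᶻ (N *ᶻ N *ᶻ N *ᶻ N -ᶻ N *ᶻ N) -ᶻ + 20 *ᶻ (N *ᶻ N *ᶻ N -ᶻ N) *ᶻ (N *ᶻ N *ᶻ N -ᶻ N)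
          -ᶻ + 60 *ᶻ (N *ᶻ N *ᶻ N *ᶻ N -ᶻ N *ᶻ N)
              +ᶻ + 12 *ᶻ (+ 7 *ᶻ (N *ᶻ N *ᶻ N *ᶻ N *ᶻ N) -ᶻ + 15 *ᶻ (N *ᶻ N *ᶻ N) +ᶻ + 8 *ᶻ N)
        ≡ N *ᶻ (N +ᶻ + 1) *ᶻ (N -ᶻ + 1) *ᶻ (N -ᶻ + 2) *ᶻ (N -ᶻ + 3) *ᶻ (N -ᶻ + 4)
      evaluate = ℤ-solve-∀

  +disjoint-sum : ∀ n → + injectiveSum n 4 dist-disjoint +ᶻ + 4 *ᶻ + sumRowSum² n
                        ≡ + sumDist n *ᶻ + sumDist n +ᶻ + 2 *ᶻ + sumDist² n
  +disjoint-sum n = begin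
    + injectiveSum n 4 dist-disjoint +ᶻ + 4 *ᶻ + sumRowSum² n
      ≡⟨ trans (cong (+ injectiveSum n 4 dist-disjoint +ᶻ_) (sym (ℤₚ.pos-* 4 (sumRowSum² n))))
               (sym (ℤₚ.pos-+ (injectiveSum n 4 dist-disjoint) (4 * sumRowSum² n))) ⟩
    + (injectiveSum n 4 dist-disjoint + 4 * sumRowSum² n)
      ≡⟨ cong +_ (injectiveSum-dist-disjoint n) ⟩
    + (sumDist n * sumDist n + 2 * sumDist² n)
      ≡⟨ trans (ℤₚ.pos-+ (sumDist n * sumDist n) (2 * sumDist² n))
               (cong₂ _+ᶻ_ (ℤₚ.pos-* (sumDist n) (sumDist n)) (ℤₚ.pos-* 2 (sumDist² n))) ⟩
    + sumDist n *ᶻ + sumDist n +ᶻ + 2 *ᶻ + sumDist² n ∎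
    where open ≡-Reasoning

  module ClosedFormIdentities (n : ℕ) = DistanceSumIdentities
    (+ n) (+ sumDist n) (+ sumDist² n) (+ sumRowSum² n) (+ injectiveSum n 3 dist-path) (+ injectiveSum n 4 dist-disjoint)
    (sumDist-closed n) (sumDist²-closed n) (sumRowSum²-closed n)
    (trans (sym (ℤₚ.pos-+ (injectiveSum n 3 dist-path) (sumDist² n))) (cong +_ (injectiveSum-dist-path n)))
    (+disjoint-sum n)

  +suc-1 : ∀ m → + m ≡ + suc m -ᶻ + 1
  +suc-1 m = trans (shift (+ m)) (cong (_-ᶻ + 1) (sym (ℤₚ.pos-+ 1 m)))
    where
    shift : ∀ M → M ≡ (+ 1 +ᶻ M) -ᶻ + 1
    shift = ℤ-solve-∀

  cross-scale : ∀ f x c p y → + x *ᶻ c ≡ p *ᶻ y → + (f * x) *ᶻ c ≡ p *ᶻ (y *ᶻ + f)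
  cross-scale f x c p y eq = begin
    + (f * x) *ᶻ c      ≡⟨ cong (_*ᶻ c) (ℤₚ.pos-* f x) ⟩
    + f *ᶻ + x *ᶻ c     ≡⟨ ℤₚ.*-assoc (+ f) (+ x) c ⟩
    + f *ᶻ (+ x *ᶻ c)   ≡⟨ cong (+ f *ᶻ_) eq ⟩
    + f *ᶻ (p *ᶻ y)     ≡⟨ rotate (+ f) p y ⟩
    p *ᶻ (y *ᶻ + f)     ∎
    where
    open ≡-Reasoning
    rotate : ∀ F p y → F *ᶻ (p *ᶻ y) ≡ p *ᶻ (y *ᶻ F)
    rotate = ℤ-solve-∀

  +n! : ∀ r → let n = 4 + r in + n *ᶻ (+ n -ᶻ + 1) *ᶻ + ((2 + r) !) ≡ + (n !)
  +n! r = sym (begin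
    + ((4 + r) * ((3 + r) * (2 + r) !))
      ≡⟨ trans (ℤₚ.pos-* (4 + r) ((3 + r) * (2 + r) !)) (cong (+ (4 + r) *ᶻ_) (ℤₚ.pos-* (3 + r) ((2 + r) !))) ⟩
    + (4 + r) *ᶻ (+ (3 + r) *ᶻ + ((2 + r) !))
      ≡⟨ cong (λ m → + (4 + r) *ᶻ (m *ᶻ + ((2 + r) !))) (+suc-1 (3 + r)) ⟩
    + (4 + r) *ᶻ ((+ (4 + r) -ᶻ + 1) *ᶻ + ((2 + r) !))
      ≡⟨ sym (ℤₚ.*-assoc (+ (4 + r)) (+ (4 + r) -ᶻ + 1) (+ ((2 + r) !))) ⟩
    + (4 + r) *ᶻ (+ (4 + r) -ᶻ + 1) *ᶻ + ((2 + r) !) ∎)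
    where open ≡-Reasoning

  path-E²-cross : ∀ r → let n = 4 + r in
    + totalWeight n (pathEdges n) *ᶻ + 90
      ≡ pathNumerator (+ n) *ᶻ + (n !)
  path-E²-cross r = begin
    + totalWeight n (pathEdges n) *ᶻ + 90
      ≡⟨ cong (λ x → + x *ᶻ + 90) (path-total r) ⟩
    + ((2 + r) ! * ((3 + r) * S₂ + 2 * B + C)) *ᶻ + 90
      ≡⟨ cross-scale ((2 + r) !) ((3 + r) * S₂ + 2 * B + C) (+ 90) (pathNumerator (+ n)) (+ n *ᶻ (+ n -ᶻ + 1))
                     (trans (cong (_*ᶻ + 90) +path-sum) (ClosedFormIdentities.path-moment n)) ⟩
    pathNumerator (+ n) *ᶻ (+ n *ᶻ (+ n -ᶻ + 1) *ᶻ + ((2 + r) !))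
      ≡⟨ cong (pathNumerator (+ n) *ᶻ_) (+n! r) ⟩
    pathNumerator (+ n) *ᶻ + (n !) ∎
    where
    open ≡-Reasoning
    n : ℕ
    n = 4 + r
    S₂ : ℕ
    S₂ = sumDist² n
    B : ℕ
    B = injectiveSum n 3 dist-path
    C : ℕ
    C = injectiveSum n 4 dist-disjoint
    +path-sum : + ((3 + r) * S₂ + 2 * B + C) ≡ (+ n -ᶻ + 1) *ᶻ + S₂ +ᶻ + 2 *ᶻ + B +ᶻ + C
    +path-sum = trans (ℤₚ.pos-+ ((3 + r) * S₂ + 2 * B) C) (cong (_+ᶻ + C)
      (trans (ℤₚ.pos-+ ((3 + r) * S₂) (2 * B))
             (cong₂ _+ᶻ_ (trans (ℤₚ.pos-* (3 + r) S₂) (cong (_*ᶻ + S₂) (+suc-1 (3 + r)))) (ℤₚ.pos-* 2 B))))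

  star-E²-cross : ∀ r → let n = 4 + r in
    + totalWeight n (starEdges n) *ᶻ + 60
      ≡ starNumerator (+ n) *ᶻ + (n !)
  star-E²-cross r = begin
    + totalWeight n (starEdges n) *ᶻ + 60
      ≡⟨ cong (λ x → + x *ᶻ + 60) (star-total r) ⟩
    + ((2 + r) ! * ((3 + r) * sumRowSum² n)) *ᶻ + 60
      ≡⟨ cross-scale ((2 + r) !) ((3 + r) * sumRowSum² n) (+ 60) (starNumerator (+ n)) (+ n *ᶻ (+ n -ᶻ + 1))
                     (trans (cong (_*ᶻ + 60) +star-sum) (ClosedFormIdentities.star-moment n)) ⟩
    starNumerator (+ n) *ᶻ (+ n *ᶻ (+ n -ᶻ + 1) *ᶻ + ((2 + r) !))
      ≡⟨ cong (starNumerator (+ n) *ᶻ_) (+n! r) ⟩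
    starNumerator (+ n) *ᶻ + (n !) ∎
    where
    open ≡-Reasoning
    n : ℕ
    n = 4 + r
    +star-sum : + ((3 + r) * sumRowSum² n) ≡ (+ n -ᶻ + 1) *ᶻ + sumRowSum² n
    +star-sum = trans (ℤₚ.pos-* (3 + r) (sumRowSum² n)) (cong (_*ᶻ + sumRowSum² n) (+suc-1 (3 + r)))

  edge-E-cross : ∀ r → let n = 4 + r in
    + ((3 + r) * weight-edge n) *ᶻ + 3 ≡ edgeNumerator (+ n) *ᶻ + (n !)
  edge-E-cross r = begin
    + ((3 + r) * weight-edge n) *ᶻ + 3
      ≡⟨ cong (λ x → + x *ᶻ + 3) (trans (cong (λ s → (3 + r) * ((2 + r) ! * s)) (injectiveSum-dist₁ n))
                                         (swap (3 + r) ((2 + r) !) (sumDist n))) ⟩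
    + ((2 + r) ! * ((3 + r) * sumDist n)) *ᶻ + 3
      ≡⟨ cross-scale ((2 + r) !) ((3 + r) * sumDist n) (+ 3) (edgeNumerator (+ n)) (+ n *ᶻ (+ n -ᶻ + 1))
                     (trans (cong (_*ᶻ + 3) +edge-sum) (ClosedFormIdentities.edge-moment n)) ⟩
    edgeNumerator (+ n) *ᶻ (+ n *ᶻ (+ n -ᶻ + 1) *ᶻ + ((2 + r) !))
      ≡⟨ cong (edgeNumerator (+ n) *ᶻ_) (+n! r) ⟩
    edgeNumerator (+ n) *ᶻ + (n !) ∎
    where
    open ≡-Reasoning
    n : ℕ
    n = 4 + r
    swap : ∀ a f s → a * (f * s) ≡ f * (a * s)
    swap = solve-∀
    +edge-sum : + ((3 + r) * sumDist n) ≡ (+ n -ᶻ + 1) *ᶻ + sumDist n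
    +edge-sum = trans (ℤₚ.pos-* (3 + r) (sumDist n)) (cong (_*ᶻ + sumDist n) (+suc-1 (3 + r)))

  disjoint≤adjacent : ∀ r → let n = 4 + r in injectiveSum n 4 dist-disjoint ≤ (1 + r) * injectiveSum n 3 dist-path
  disjoint≤adjacent r = ℕₚ.*-cancelˡ-≤ 180 (subst (180 * C ≤_) nat-identity (ℕₚ.m≤m+n (180 * C) P))
    where
    open ≡-Reasoning
    n : ℕ
    n = 4 + r
    B : ℕ
    B = injectiveSum n 3 dist-path
    C : ℕ
    C = injectiveSum n 4 dist-disjoint
    P : ℕ
    P = r * (1 + r) * (2 + r) * (3 + r) * (4 + r) * (5 + r)
    +*+ : ∀ a k → + (a * (k + r)) ≡ + a *ᶻ (+ k +ᶻ + r)
    +*+ a k = trans (ℤₚ.pos-* a (k + r)) (cong (+ a *ᶻ_) (ℤₚ.pos-+ k r))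
    +P : + P ≡ + r *ᶻ (+ 1 +ᶻ + r) *ᶻ (+ 2 +ᶻ + r) *ᶻ (+ 3 +ᶻ + r) *ᶻ (+ 4 +ᶻ + r) *ᶻ (+ 5 +ᶻ + r)
    +P = trans (+*+ (r * (1 + r) * (2 + r) * (3 + r) * (4 + r)) 5) (cong (_*ᶻ (+ 5 +ᶻ + r))
           (trans (+*+ (r * (1 + r) * (2 + r) * (3 + r)) 4) (cong (_*ᶻ (+ 4 +ᶻ + r))
             (trans (+*+ (r * (1 + r) * (2 + r)) 3) (cong (_*ᶻ (+ 3 +ᶻ + r))
               (trans (+*+ (r * (1 + r)) 2) (cong (_*ᶻ (+ 2 +ᶻ + r)) (+*+ r 1))))))))
    shift : ∀ R → ((+ 4 +ᶻ R) -ᶻ + 3) ≡ + 1 +ᶻ R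
    shift = ℤ-solve-∀
    product : ∀ R → (+ 4 +ᶻ R) *ᶻ ((+ 4 +ᶻ R) +ᶻ + 1) *ᶻ ((+ 4 +ᶻ R) -ᶻ + 1) *ᶻ ((+ 4 +ᶻ R) -ᶻ + 2)
                      *ᶻ ((+ 4 +ᶻ R) -ᶻ + 3) *ᶻ ((+ 4 +ᶻ R) -ᶻ + 4)
                    ≡ R *ᶻ (+ 1 +ᶻ R) *ᶻ (+ 2 +ᶻ R) *ᶻ (+ 3 +ᶻ R) *ᶻ (+ 4 +ᶻ R) *ᶻ (+ 5 +ᶻ R)
    product = ℤ-solve-∀
    rearrange : ∀ X c p → + 180 *ᶻ (X -ᶻ c) ≡ p → + 180 *ᶻ c +ᶻ p ≡ + 180 *ᶻ X
    rearrange X c p refl = cancel X c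
      where
      cancel : ∀ X c → + 180 *ᶻ c +ᶻ + 180 *ᶻ (X -ᶻ c) ≡ + 180 *ᶻ X
      cancel = ℤ-solve-∀
    +1+r : + (1 + r) ≡ + n -ᶻ + 3
    +1+r = trans (ℤₚ.pos-+ 1 r) (sym (trans (cong (_-ᶻ + 3) (ℤₚ.pos-+ 4 r)) (shift (+ r))))
    int-identity : + 180 *ᶻ (+ ((1 + r) * B) -ᶻ + C) ≡ + P
    int-identity = begin
      + 180 *ᶻ (+ ((1 + r) * B) -ᶻ + C)
        ≡⟨ cong (λ x → + 180 *ᶻ (x -ᶻ + C)) (trans (ℤₚ.pos-* (1 + r) B) (cong (_*ᶻ + B) +1+r)) ⟩
      + 180 *ᶻ ((+ n -ᶻ + 3) *ᶻ + B -ᶻ + C)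
        ≡⟨ ClosedFormIdentities.adjacent-minus-disjoint n ⟩
      + n *ᶻ (+ n +ᶻ + 1) *ᶻ (+ n -ᶻ + 1) *ᶻ (+ n -ᶻ + 2) *ᶻ (+ n -ᶻ + 3) *ᶻ (+ n -ᶻ + 4)
        ≡⟨ cong (λ N → N *ᶻ (N +ᶻ + 1) *ᶻ (N -ᶻ + 1) *ᶻ (N -ᶻ + 2) *ᶻ (N -ᶻ + 3) *ᶻ (N -ᶻ + 4)) (ℤₚ.pos-+ 4 r) ⟩
      (+ 4 +ᶻ + r) *ᶻ ((+ 4 +ᶻ + r) +ᶻ + 1) *ᶻ ((+ 4 +ᶻ + r) -ᶻ + 1) *ᶻ ((+ 4 +ᶻ + r) -ᶻ + 2)
        *ᶻ ((+ 4 +ᶻ + r) -ᶻ + 3) *ᶻ ((+ 4 +ᶻ + r) -ᶻ + 4)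
        ≡⟨ trans (product (+ r)) (sym +P) ⟩
      + P ∎
    nat-identity : 180 * C + P ≡ 180 * ((1 + r) * B)
    nat-identity = ℤₚ.+-injective (begin
      + (180 * C + P)                 ≡⟨ trans (ℤₚ.pos-+ (180 * C) P) (cong (_+ᶻ + P) (ℤₚ.pos-* 180 C)) ⟩
      + 180 *ᶻ + C +ᶻ + P             ≡⟨ rearrange (+ ((1 + r) * B)) (+ C) (+ P) int-identity ⟩
      + 180 *ᶻ + ((1 + r) * B)        ≡⟨ sym (ℤₚ.pos-* 180 ((1 + r) * B)) ⟩
      + (180 * ((1 + r) * B))         ∎)

  weight₀≤weight₁ : ∀ n → weight₀ n ≤ weight₁ n
  weight₀≤weight₁ 0 = z≤n
  weight₀≤weight₁ 1 = z≤n
  weight₀≤weight₁ 2 = z≤n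
  weight₀≤weight₁ 3 = z≤n
  weight₀≤weight₁ (suc (suc (suc (suc r)))) =
    subst (r ! * injectiveSum n 4 dist-disjoint ≤_) (reassociate (r !) (1 + r) (injectiveSum n 3 dist-path))
          (ℕₚ.*-monoʳ-≤ (r !) (disjoint≤adjacent r))
    where
    n : ℕ
    n = 4 + r
    reassociate : ∀ f a b → f * (a * b) ≡ a * f * b
    reassociate = solve-∀

  /-cross : ∀ x k p d → + x *ᶻ + suc d ≡ p *ᶻ + suc k → (+ x) ℚ./ suc k ≡ p ℚ./ suc d
  /-cross x k p d eq = ℚₚ.fromℚᵘ-cong {mkℚᵘ (+ x) k} {mkℚᵘ p d} (*≡* eq)

  /-mono-≤ : ∀ x y k → x ≤ y → (+ x) ℚ./ suc k ℚ.≤ (+ y) ℚ./ suc k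
  /-mono-≤ x y k x≤y = ℚₚ.toℚᵘ-cancel-≤
    (ℚᵘₚ.≤-respˡ-≃ (ℚᵘₚ.≃-sym (ℚₚ.toℚᵘ-fromℚᵘ (mkℚᵘ (+ x) k)))
      (ℚᵘₚ.≤-respʳ-≃ (ℚᵘₚ.≃-sym (ℚₚ.toℚᵘ-fromℚᵘ (mkℚᵘ (+ y) k)))
        (*≤* (subst₂ ℤ._≤_ (ℤₚ.pos-* x (suc k)) (ℤₚ.pos-* y (suc k)) (ℤ.+≤+ (ℕₚ.*-monoˡ-≤ (suc k) x≤y))))))

  fromℚᵘ-variance : ∀ (u₂ u₁ v : ℚᵘ) → (u₂ ℚᵘ.- u₁ ℚᵘ.* u₁) ℚᵘ.≃ v →
                    ℚ.fromℚᵘ u₂ ℚ.- ℚ.fromℚᵘ u₁ ℚ.* ℚ.fromℚᵘ u₁ ≡ ℚ.fromℚᵘ v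
  fromℚᵘ-variance u₂ u₁ v eq = ℚₚ.toℚᵘ-injective (ℚᵘₚ.≃-trans homo (ℚᵘₚ.≃-sym (ℚₚ.toℚᵘ-fromℚᵘ v)))
    where
    a : ℚ
    a = ℚ.fromℚᵘ u₂
    b : ℚ
    b = ℚ.fromℚᵘ u₁
    homo : ℚ.toℚᵘ (a ℚ.- b ℚ.* b) ℚᵘ.≃ v
    homo = ℚᵘₚ.≃-trans (ℚₚ.toℚᵘ-homo-+ a (ℚ.- (b ℚ.* b)))
             (ℚᵘₚ.≃-trans (ℚᵘₚ.+-cong (ℚₚ.toℚᵘ-fromℚᵘ u₂)
                            (ℚᵘₚ.≃-trans (ℚₚ.toℚᵘ-homo‿- (b ℚ.* b))
                              (ℚᵘₚ.-‿cong (ℚᵘₚ.≃-trans (ℚₚ.toℚᵘ-homo-* b b)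
                                             (ℚᵘₚ.*-cong (ℚₚ.toℚᵘ-fromℚᵘ u₁) (ℚₚ.toℚᵘ-fromℚᵘ u₁))))))
                          eq)

  variance/90 : ∀ p e v → p -ᶻ + 10 *ᶻ (e *ᶻ e) ≡ v → (p ℚ./ 90) ℚ.- (e ℚ./ 3) ℚ.* (e ℚ./ 3) ≡ v ℚ./ 90
  variance/90 p e v eq = fromℚᵘ-variance (mkℚᵘ p 89) (mkℚᵘ e 2) (mkℚᵘ v 89) (*≡* (trans (cross p e) (cong (_*ᶻ + 810) eq)))
    where
    cross : ∀ p e → (p *ᶻ + 9 +ᶻ (- (e *ᶻ e)) *ᶻ + 90) *ᶻ + 90 ≡ (p -ᶻ + 10 *ᶻ (e *ᶻ e)) *ᶻ + 810
    cross = ℤ-solve-∀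

  variance/60 : ∀ p e v → + 3 *ᶻ p -ᶻ + 20 *ᶻ (e *ᶻ e) ≡ v → (p ℚ./ 60) ℚ.- (e ℚ./ 3) ℚ.* (e ℚ./ 3) ≡ v ℚ./ 180
  variance/60 p e v eq = fromℚᵘ-variance (mkℚᵘ p 59) (mkℚᵘ e 2) (mkℚᵘ v 179) (*≡* (trans (cross p e) (cong (_*ᶻ + 540) eq)))
    where
    cross : ∀ p e → (p *ᶻ + 9 +ᶻ (- (e *ᶻ e)) *ᶻ + 60) *ᶻ + 180 ≡ (+ 3 *ᶻ p -ᶻ + 20 *ᶻ (e *ᶻ e)) *ᶻ + 540
    cross = ℤ-solve-∀

  mean-suc : ∀ (xs : List ℕ) {k} → length xs ≡ suc k → mean xs ≡ (+ sum xs) ℚ./ suc k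
  mean-suc xs len with length xs | len
  ... | _ | refl = refl

  length-moments : ∀ n (f : Vec (Fin n) n → ℕ) → length (map f (arrangements n)) ≡ suc (ℕ.pred (n !))
  length-moments n f = trans (Listₚ.length-map f (arrangements n))
                             (trans (length-arrangements n) (sym (ℕₚ.suc-pred (n !) {{n ℕₚ.!≢0}})))

  E-D²≡ : ∀ n (es : List (Edge n)) → All Ordered es →
          E-D² n es ≡ (+ totalWeight n es) ℚ./ suc (ℕ.pred (n !))
  E-D²≡ n es ordered = trans (mean-suc (map (λ π → D π es ^ 2) (arrangements n)) (length-moments n (λ π → D π es ^ 2)))
    (cong (λ x → (+ x) ℚ./ suc (ℕ.pred (n !))) (trans (∑-D² n es) (∑∑pairWeight es ordered)))

  E-D≡ : ∀ n (es : List (Edge n)) → All Ordered es →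
         E-D n es ≡ (+ (length es * weight-edge n)) ℚ./ suc (ℕ.pred (n !))
  E-D≡ n es ordered = trans (mean-suc (map (λ π → D π es) (arrangements n)) (length-moments n (λ π → D π es)))
    (cong (λ x → (+ x) ℚ./ suc (ℕ.pred (n !))) (trans (∑-D n es) (∑-edgeWeight es ordered)))

  +suc-pred! : ∀ n → + suc (ℕ.pred (n !)) ≡ + (n !)
  +suc-pred! n = cong +_ (ℕₚ.suc-pred (n !) {{n ℕₚ.!≢0}})

  -- Comparing trees

  totalWeight-≤ : ∀ {n} (es fs : List (Edge n)) → All Ordered es → All Ordered fs → length es ≡ length fs →
    incidenceSum isTwo es ≡ incidenceSum isTwo fs → incidenceSum isOne es ≤ incidenceSum isOne fs →
    totalWeight n es ≤ totalWeight n fs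
  totalWeight-≤ {n} es fs oes ofs len twos ones = subst₂ _≤_
    (sym (incidenceSum-weights es oes))
    (trans (cong (λ a → a * weight₂ n + incidenceSum isOne fs * weight₁ n + incidenceSum isZero fs * weight₀ n) twos)
           (sym (incidenceSum-weights fs ofs)))
    (exchange-≤ (incidenceSum isTwo es) (incidenceSum isOne es) (incidenceSum isZero es)
                (incidenceSum isOne fs) (incidenceSum isZero fs) (weight₂ n) (weight₁ n) (weight₀ n)
                (weight₀≤weight₁ n) others ones)
    where
    others : incidenceSum isOne es + incidenceSum isZero es ≡ incidenceSum isOne fs + incidenceSum isZero fs
    others = ℕₚ.+-cancelˡ-≡ (incidenceSum isTwo es) _ _ (begin
      incidenceSum isTwo es + (incidenceSum isOne es + incidenceSum isZero es)
        ≡⟨ sym (ℕₚ.+-assoc (incidenceSum isTwo es) _ _) ⟩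
      incidenceSum isTwo es + incidenceSum isOne es + incidenceSum isZero es
        ≡⟨ incidenceSum-counts es oes ⟩
      length es * length es
        ≡⟨ cong (λ l → l * l) len ⟩
      length fs * length fs
        ≡⟨ sym (incidenceSum-counts fs ofs) ⟩
      incidenceSum isTwo fs + incidenceSum isOne fs + incidenceSum isZero fs
        ≡⟨ trans (ℕₚ.+-assoc (incidenceSum isTwo fs) _ _) (cong (_+ _) (sym twos)) ⟩
      incidenceSum isTwo es + (incidenceSum isOne fs + incidenceSum isZero fs) ∎)
      where open ≡-Reasoning

  path-isTwo : ∀ k → incidenceSum isTwo (pathEdges (2 + k)) ≡ suc k
  path-isTwo k = ℕₚ.+-cancelʳ-≡ (k * 0) _ _ (trans (incidenceSum-path k isTwo) (arith k))
    where
    arith : ∀ k → (k + 1) * 1 + 2 * k * 0 + k * k * 0 ≡ suc k + k * 0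
    arith = solve-∀

  path-isOne : ∀ k → incidenceSum isOne (pathEdges (2 + k)) ≡ 2 * k
  path-isOne k = ℕₚ.+-cancelʳ-≡ (k * 0) _ _ (trans (incidenceSum-path k isOne) (arith k))
    where
    arith : ∀ k → (k + 1) * 0 + 2 * k * 1 + k * k * 0 ≡ 2 * k + k * 0
    arith = solve-∀

  star-isTwo : ∀ k → incidenceSum isTwo (starEdges (2 + k)) ≡ suc k
  star-isTwo k = ℕₚ.+-cancelʳ-≡ (suc k * 0) _ _ (trans (incidenceSum-star (suc k) isTwo) (arith k))
    where
    arith : ∀ k → suc k * (suc k * 0 + 1) ≡ suc k + suc k * 0
    arith = solve-∀

  star-isZero : ∀ k → incidenceSum isZero (starEdges (2 + k)) ≡ 0
  star-isZero k = ℕₚ.+-cancelʳ-≡ (suc k * 0) _ _ (trans (incidenceSum-star (suc k) isZero) (arith k))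
    where
    arith : ∀ k → suc k * (suc k * 0 + 0) ≡ 0 + suc k * 0
    arith = solve-∀

  path≤tree : ∀ k (T : List (Edge (2 + k))) → IsTree (2 + k) T →
              totalWeight (2 + k) (pathEdges (2 + k)) ≤ totalWeight (2 + k) T
  path≤tree k T ((ordered , unique) , connected , len) =
    totalWeight-≤ (pathEdges (2 + k)) T (pathEdges-ordered (2 + k)) ordered
      (trans (length-pathEdges (suc k)) (sym len))
      (trans (path-isTwo k) (sym (trans (incidenceSum-isTwo T unique ordered) len)))
      (subst (_≤ incidenceSum isOne T) (sym (path-isOne k)) (tree-isOne≥ k T unique ordered connected len))

  tree≤star : ∀ k (T : List (Edge (2 + k))) → IsTree (2 + k) T →
              totalWeight (2 + k) T ≤ totalWeight (2 + k) (starEdges (2 + k))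
  tree≤star k T ((ordered , unique) , _ , len) =
    totalWeight-≤ T star ordered (starEdges-ordered (suc k))
      (trans len (sym (length-starEdges (suc k))))
      (trans T-isTwo (sym (star-isTwo k)))
      (subst (incidenceSum isOne T ≤_) adjacent-pairs (ℕₚ.m≤m+n (incidenceSum isOne T) (incidenceSum isZero T)))
    where
    star : List (Edge (2 + k))
    star = starEdges (2 + k)
    T-isTwo : incidenceSum isTwo T ≡ suc k
    T-isTwo = trans (incidenceSum-isTwo T unique ordered) len
    adjacent-pairs : incidenceSum isOne T + incidenceSum isZero T ≡ incidenceSum isOne star
    adjacent-pairs = ℕₚ.+-cancelˡ-≡ (suc k) _ _ (begin
      suc k + (incidenceSum isOne T + incidenceSum isZero T)
        ≡⟨ trans (cong (_+ (incidenceSum isOne T + incidenceSum isZero T)) (sym T-isTwo))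
                 (sym (ℕₚ.+-assoc (incidenceSum isTwo T) _ _)) ⟩
      incidenceSum isTwo T + incidenceSum isOne T + incidenceSum isZero T
        ≡⟨ trans (incidenceSum-counts T ordered) (cong (λ l → l * l) len) ⟩
      suc k * suc k
        ≡⟨ trans (cong (λ l → l * l) (sym (length-starEdges (suc k))))
                 (sym (incidenceSum-counts star (starEdges-ordered (suc k)))) ⟩
      incidenceSum isTwo star + incidenceSum isOne star + incidenceSum isZero star
        ≡⟨ cong₂ (λ a z → a + incidenceSum isOne star + z) (star-isTwo k) (star-isZero k) ⟩
      suc k + incidenceSum isOne star + 0
        ≡⟨ ℕₚ.+-identityʳ _ ⟩
      suc k + incidenceSum isOne star ∎)
      where open ≡-Reasoning

  record ExactMoments (n : ℕ) : Set where
    field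
      path-E² : + totalWeight n (pathEdges n) *ᶻ + 90 ≡ pathNumerator (+ n) *ᶻ + (n !)
      star-E² : + totalWeight n (starEdges n) *ᶻ + 60 ≡ starNumerator (+ n) *ᶻ + (n !)
      edge-E  : + ((n ∸ 1) * weight-edge n) *ᶻ + 3 ≡ edgeNumerator (+ n) *ᶻ + (n !)

  exactMoments : ∀ k → ExactMoments (2 + k)
  exactMoments 0             = record { path-E² = refl ; star-E² = refl ; edge-E = refl }
  exactMoments 1             = record { path-E² = refl ; star-E² = refl ; edge-E = refl }
  exactMoments (suc (suc r)) = record { path-E² = path-E²-cross r ; star-E² = star-E²-cross r ; edge-E = edge-E-cross r }

  module _ (k : ℕ) where

    private
      n : ℕ
      n = 2 + k
      open ExactMoments (exactMoments k)
      /n! : ∀ x p d → + x *ᶻ + suc d ≡ p *ᶻ + (n !) → (+ x) ℚ./ suc (ℕ.pred (n !)) ≡ p ℚ./ suc d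
      /n! x p d eq = /-cross x (ℕ.pred (n !)) p d (trans eq (cong (p *ᶻ_) (sym (+suc-pred! n))))

    E-D-tree : ∀ (es : List (Edge n)) → All Ordered es → length es ≡ suc k → E-D n es ≡ edgeNumerator (+ n) ℚ./ 3
    E-D-tree es ordered len = trans (E-D≡ n es ordered) (trans
      (cong (λ l → (+ (l * weight-edge n)) ℚ./ suc (ℕ.pred (n !))) len)
      (/n! (suc k * weight-edge n) (edgeNumerator (+ n)) 2 edge-E))

    E-D²-path : E-D² n (pathEdges n) ≡ pathNumerator (+ n) ℚ./ 90
    E-D²-path = trans (E-D²≡ n (pathEdges n) (pathEdges-ordered n))
                      (/n! (totalWeight n (pathEdges n)) (pathNumerator (+ n)) 89 path-E²)

    E-D²-star : E-D² n (starEdges n) ≡ starNumerator (+ n) ℚ./ 60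
    E-D²-star = trans (E-D²≡ n (starEdges n) (starEdges-ordered (suc k)))
                      (/n! (totalWeight n (starEdges n)) (starNumerator (+ n)) 59 star-E²)

    V-D-path : V-D n (pathEdges n) ≡ pathVarianceNumerator (+ n) ℚ./ 90
    V-D-path = trans
      (cong₂ (λ e² e → e² ℚ.- e ℚ.* e) E-D²-path (E-D-tree (pathEdges n) (pathEdges-ordered n) (length-pathEdges (suc k))))
      (variance/90 (pathNumerator (+ n)) (edgeNumerator (+ n)) (pathVarianceNumerator (+ n)) (numerators (+ n)))
      where
      numerators : ∀ N → (N +ᶻ + 1) *ᶻ (+ 10 *ᶻ N *ᶻ N *ᶻ N -ᶻ + 6 *ᶻ N *ᶻ N -ᶻ + 25 *ᶻ N +ᶻ + 24)
                         -ᶻ + 10 *ᶻ (((N +ᶻ + 1) *ᶻ (N -ᶻ + 1)) *ᶻ ((N +ᶻ + 1) *ᶻ (N -ᶻ + 1)))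
                       ≡ (N +ᶻ + 1) *ᶻ (N -ᶻ + 2) *ᶻ (+ 4 *ᶻ N -ᶻ + 7)
      numerators = ℤ-solve-∀

    V-D-star : V-D n (starEdges n) ≡ starVarianceNumerator (+ n) ℚ./ 180
    V-D-star = trans
      (cong₂ (λ e² e → e² ℚ.- e ℚ.* e) E-D²-star
             (E-D-tree (starEdges n) (starEdges-ordered (suc k)) (length-starEdges (suc k))))
      (variance/60 (starNumerator (+ n)) (edgeNumerator (+ n)) (starVarianceNumerator (+ n)) (numerators (+ n)))
      where
      numerators : ∀ N → + 3 *ᶻ ((N +ᶻ + 1) *ᶻ (N -ᶻ + 1) *ᶻ (+ 7 *ᶻ N *ᶻ N -ᶻ + 8))
                         -ᶻ + 20 *ᶻ (((N +ᶻ + 1) *ᶻ (N -ᶻ + 1)) *ᶻ ((N +ᶻ + 1) *ᶻ (N -ᶻ + 1)))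
                       ≡ (N +ᶻ + 1) *ᶻ (N -ᶻ + 1) *ᶻ (N +ᶻ + 2) *ᶻ (N -ᶻ + 2)
      numerators = ℤ-solve-∀

    E-D²-mono : ∀ (es fs : List (Edge n)) → All Ordered es → All Ordered fs →
                totalWeight n es ≤ totalWeight n fs → E-D² n es ℚ.≤ E-D² n fs
    E-D²-mono es fs oes ofs ≤ = subst₂ ℚ._≤_ (sym (E-D²≡ n es oes)) (sym (E-D²≡ n fs ofs))
                                           (/-mono-≤ (totalWeight n es) (totalWeight n fs) (ℕ.pred (n !)) ≤)

    V-D-mono : ∀ (es fs : List (Edge n)) → E-D n es ≡ E-D n fs → E-D² n es ℚ.≤ E-D² n fs → V-D n es ℚ.≤ V-D n fs
    V-D-mono es fs e≡ ≤ = subst (λ e → E-D² n es ℚ.- e ℚ.* e ℚ.≤ V-D n fs) (sym e≡)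
                                 (ℚₚ.+-monoˡ-≤ (ℚ.- (E-D n fs ℚ.* E-D n fs)) ≤)

  module _ (k : ℕ) (T : List (Edge (2 + k))) (tree : IsTree (2 + k) T) where

    private
      ordered : All Ordered T
      ordered = proj₁ (proj₁ tree)
      E-D-T : E-D (2 + k) T ≡ edgeNumerator (+ (2 + k)) ℚ./ 3
      E-D-T = E-D-tree k T ordered (proj₂ (proj₂ tree))

    E-D²-path≤tree : E-D² (2 + k) (pathEdges (2 + k)) ℚ.≤ E-D² (2 + k) T
    E-D²-path≤tree = E-D²-mono k (pathEdges (2 + k)) T (pathEdges-ordered (2 + k)) ordered (path≤tree k T tree)

    E-D²-tree≤star : E-D² (2 + k) T ℚ.≤ E-D² (2 + k) (starEdges (2 + k))
    E-D²-tree≤star = E-D²-mono k T (starEdges (2 + k)) ordered (starEdges-ordered (suc k)) (tree≤star k T tree)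

    V-D-path≤tree : V-D (2 + k) (pathEdges (2 + k)) ℚ.≤ V-D (2 + k) T
    V-D-path≤tree = V-D-mono k (pathEdges (2 + k)) T
      (trans (E-D-tree k (pathEdges (2 + k)) (pathEdges-ordered (2 + k)) (length-pathEdges (suc k))) (sym E-D-T))
      E-D²-path≤tree

    V-D-tree≤star : V-D (2 + k) T ℚ.≤ V-D (2 + k) (starEdges (2 + k))
    V-D-tree≤star = V-D-mono k T (starEdges (2 + k))
      (trans E-D-T (sym (E-D-tree k (starEdges (2 + k)) (starEdges-ordered (suc k)) (length-starEdges (suc k)))))
      E-D²-tree≤star

open import Defs
open import Data.Nat using (ℕ; _≤_; suc; s≤s; z≤n)
open import Data.List using (List)
open import Data.Product using (_×_; _,_)
open import Data.Integer using (+_; _+_; _-_; _*_)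
open import Data.Rational using (ℚ; _/_)
open import Relation.Binary.PropositionalEquality using (_≡_)
import Data.Rational as Q
open ClosedForms
  using (E-D²-path; E-D²-star; V-D-path; V-D-star; E-D²-path≤tree; E-D²-tree≤star; V-D-path≤tree; V-D-tree≤star)

mainTheorem8 : (n : ℕ) → 2 ≤ n → (T : List (Edge n)) → IsTree n T →
    (E-D² n (pathEdges n) Q.≤ E-D² n T × E-D² n T Q.≤ E-D² n (starEdges n))
    × (V-D n (pathEdges n) Q.≤ V-D n T × V-D n T Q.≤ V-D n (starEdges n))
    × (E-D² n (pathEdges n) ≡ ((+ n + + 1) * (+ 10 * + n * + n * + n - + 6 * + n * + n - + 25 * + n + + 24)) / 90)
    × (V-D n (pathEdges n) ≡ ((+ n + + 1) * (+ n - + 2) * (+ 4 * + n - + 7)) / 90)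
    × (E-D² n (starEdges n) ≡ ((+ n + + 1) * (+ n - + 1) * (+ 7 * + n * + n - + 8)) / 60)
    × (V-D n (starEdges n) ≡ ((+ n + + 1) * (+ n - + 1) * (+ n + + 2) * (+ n - + 2)) / 180)
mainTheorem8 .(suc (suc k)) (s≤s (s≤s {n = k} z≤n)) T tree =
    (E-D²-path≤tree k T tree , E-D²-tree≤star k T tree)
  , (V-D-path≤tree k T tree , V-D-tree≤star k T tree)
  , E-D²-path k , V-D-path k , E-D²-star k , V-D-star k
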